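{- Let $\mathbf{C}$ be a locally finitely presentable category, and let $(\Sigma,\Gamma,d)$ be a simple structural law on $\mathbf{C}$, with $$d_{X,Y}\colon \Gamma(\Sigma X,Y)\to S\bigl(\Gamma(X,SY)+X+Y\bigr),\qquad S=\Sigma^* .$$ Let $T$ be the free monad on the endofunctor $\Gamma_S\Delta\colon X\mapsto\Gamma(X,SX)$. Then $d$ induces a monad distributive law $\delta\colon TS\to ST$ such that, for every object $X$, the composite $$\Gamma(\Sigma X,X)\xrightarrow{\Gamma(\eta_{\Sigma,X},\,\eta^S_X)}\Gamma(SX,SX)\xrightarrow{\Gamma(SX,\eta^S_{SX})}\Gamma(SX,SSX)\xrightarrow{\eta_{\Gamma_S,SX}}TSX\xrightarrow{\delta_X}STX$$ equals the composite $$\Gamma(\Sigma X,X)\xrightarrow{d_{X,X}}S(\Gamma(X,SX)+X+X)\xrightarrow{S[\eta_{\Gamma_S,X},\,\eta^T_X,\,\eta^T_X]}STX .$$ Furthermore, $T$ is constant-free, and the monad morphism $S\eta^T\colon S\to ST$ is admissible.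
   Context: A simple structural law on a locally finitely presentable category $\mathbf{C}$ consists of: a finitary endofunctor $\Sigma\colon\mathbf{C}\to\mathbf{C}$; a functor $\Gamma\colon\mathbf{C}^2\to\mathbf{C}$ which is cocontinuous in its first argument and finitary in its second argument; and a natural transformation (natural in $X$ and $Y$) $d_{X,Y}\colon\Gamma(\Sigma X,Y)\to S(\Gamma(X,SY)+X+Y)$, where $S=\Sigma^*$ is the free monad on $\Sigma$. For a finitary endofunctor $F$, $\eta_F\colon F\to F^*$ denotes the canonical natural transformation into the free monad; $\eta_\Sigma\colon\Sigma\to S$ and $\eta_{\Gamma_S,X}\colon\Gamma(X,SX)\to TX$ are the instances used. $\eta^M,\mu^M$ denote unit and multiplication of a monad $M$. A monad distributive law $\delta\colon TS\to ST$ is a natural transformation commuting with units and multiplications of both monads (Beck); it makes $ST$ a monad and $S\eta^T\colon S\to ST$ a monad morphism. A monad $T$ is constant-free iff $\eta^T_\emptyset\colon\emptyset\to T\emptyset$ is an isomorphism ($\emptyset$ initial). A monad morphism $\alpha\colon R\to R'$ is admissible iff $\alpha_\emptyset$ is an isomorphism. -}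

module Defs where

open import Data.Bool.Base using (Bool; true; false)
open import Data.Empty.Polymorphic using (⊥)
open import Data.Product.Base using (Σ; Σ-syntax; _×_; _,_; proj₁; proj₂)
open import Function.Bundles using (Func)
open import Level using (Level; _⊔_; suc; Lift; lift)
open import Relation.Binary.Bundles using (Setoid)
open import Relation.Binary.PropositionalEquality as ≡ using (_≡_)
open import Relation.Binary.Structures using (IsEquivalence)
import Relation.Binary.Reasoning.Setoid as SetoidReasoning

private
  variable
    o ℓ e o′ ℓ′ e′ o″ ℓ″ e″ s : Level

record Category (o ℓ e : Level) : Set (suc (o ⊔ ℓ ⊔ e)) where
  infix  4 _≈_ _⇒_
  infixr 9 _∘_
  field
    Obj : Set o
    _⇒_ : Obj → Obj → Set ℓ
    _≈_ : ∀ {A B} → A ⇒ B → A ⇒ B → Set e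
    id  : ∀ {A} → A ⇒ A
    _∘_ : ∀ {A B C} → B ⇒ C → A ⇒ B → A ⇒ C

    isEquivalence : ∀ {A B} → IsEquivalence (_≈_ {A} {B})
    assoc     : ∀ {A B C D} {f : A ⇒ B} {g : B ⇒ C} {h : C ⇒ D} →
                (h ∘ g) ∘ f ≈ h ∘ (g ∘ f)
    identityˡ : ∀ {A B} {f : A ⇒ B} → id ∘ f ≈ f
    identityʳ : ∀ {A B} {f : A ⇒ B} → f ∘ id ≈ f
    ∘-resp-≈  : ∀ {A B C} {f h : B ⇒ C} {g i : A ⇒ B} →
                f ≈ h → g ≈ i → f ∘ g ≈ h ∘ i

  homSetoid : Obj → Obj → Setoid ℓ e
  homSetoid A B = record { isEquivalence = isEquivalence {A} {B} }

  module Equiv {A B : Obj} = IsEquivalence (isEquivalence {A} {B})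
  module HomReasoning {A B : Obj} = SetoidReasoning (homSetoid A B)

  ∘-resp-≈ˡ : ∀ {A B C} {f h : B ⇒ C} {g : A ⇒ B} → f ≈ h → f ∘ g ≈ h ∘ g
  ∘-resp-≈ˡ p = ∘-resp-≈ p Equiv.refl

  ∘-resp-≈ʳ : ∀ {A B C} {f : B ⇒ C} {g i : A ⇒ B} → g ≈ i → f ∘ g ≈ f ∘ i
  ∘-resp-≈ʳ p = ∘-resp-≈ Equiv.refl p

  extend : ∀ {A B B′ C D} {f : B ⇒ C} {g : A ⇒ B} {h : B′ ⇒ C} {i : A ⇒ B′}
           {k : D ⇒ A} → f ∘ g ≈ h ∘ i → f ∘ (g ∘ k) ≈ h ∘ (i ∘ k)
  extend p = Equiv.trans (Equiv.sym assoc) (Equiv.trans (∘-resp-≈ˡ p) assoc)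

  cancel : ∀ {A B C} {f : B ⇒ C} {g : C ⇒ B} {k : A ⇒ C} →
           f ∘ g ≈ id → f ∘ (g ∘ k) ≈ k
  cancel p = Equiv.trans (Equiv.sym assoc) (Equiv.trans (∘-resp-≈ˡ p) identityˡ)

  record IsIso {A B : Obj} (f : A ⇒ B) : Set (ℓ ⊔ e) where
    field
      inv  : B ⇒ A
      isoˡ : inv ∘ f ≈ id
      isoʳ : f ∘ inv ≈ id

  infix 4 _≅_
  _≅_ : Obj → Obj → Set (ℓ ⊔ e)
  A ≅ B = Σ (A ⇒ B) IsIso

record Functor (C : Category o ℓ e) (D : Category o′ ℓ′ e′) :
               Set (o ⊔ ℓ ⊔ e ⊔ o′ ⊔ ℓ′ ⊔ e′) where
  private
    module C = Category C
    module D = Category D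
  field
    F₀ : C.Obj → D.Obj
    F₁ : ∀ {A B} → A C.⇒ B → F₀ A D.⇒ F₀ B
    identity     : ∀ {A} → F₁ (C.id {A}) D.≈ D.id
    homomorphism : ∀ {X Y Z} {f : X C.⇒ Y} {g : Y C.⇒ Z} →
                   F₁ (g C.∘ f) D.≈ F₁ g D.∘ F₁ f
    F-resp-≈     : ∀ {A B} {f g : A C.⇒ B} → f C.≈ g → F₁ f D.≈ F₁ g

  square : ∀ {A B B′ X} {f : B C.⇒ X} {g : A C.⇒ B} {h : B′ C.⇒ X} {i : A C.⇒ B′} →
           f C.∘ g C.≈ h C.∘ i → F₁ f D.∘ F₁ g D.≈ F₁ h D.∘ F₁ i
  square p = D.Equiv.trans (D.Equiv.sym homomorphism)
                           (D.Equiv.trans (F-resp-≈ p) homomorphism)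

Endofunctor : Category o ℓ e → Set (o ⊔ ℓ ⊔ e)
Endofunctor C = Functor C C

Id : {C : Category o ℓ e} → Functor C C
Id {C = C} = record
  { F₀ = λ X → X
  ; F₁ = λ f → f
  ; identity = Equiv.refl
  ; homomorphism = Equiv.refl
  ; F-resp-≈ = λ p → p
  } where open Category C

infixr 9 _∘F_
_∘F_ : {C : Category o ℓ e} {D : Category o′ ℓ′ e′} {E : Category o″ ℓ″ e″} →
       Functor D E → Functor C D → Functor C E
_∘F_ {E = E} G F = record
  { F₀ = λ X → G.F₀ (F.F₀ X)
  ; F₁ = λ f → G.F₁ (F.F₁ f)
  ; identity = Equiv.trans (G.F-resp-≈ F.identity) G.identity
  ; homomorphism = Equiv.trans (G.F-resp-≈ F.homomorphism) G.homomorphism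
  ; F-resp-≈ = λ p → G.F-resp-≈ (F.F-resp-≈ p)
  } where
    open Category E
    module G = Functor G
    module F = Functor F

record NaturalTransformation {C : Category o ℓ e} {D : Category o′ ℓ′ e′}
                             (F G : Functor C D) : Set (o ⊔ ℓ ⊔ e ⊔ o′ ⊔ ℓ′ ⊔ e′) where
  private
    module C = Category C
    module D = Category D
    module F = Functor F
    module G = Functor G
  field
    η       : ∀ X → F.F₀ X D.⇒ G.F₀ X
    commute : ∀ {X Y} (f : X C.⇒ Y) → η Y D.∘ F.F₁ f D.≈ G.F₁ f D.∘ η X

infixr 2 _×C_
_×C_ : Category o ℓ e → Category o′ ℓ′ e′ → Category (o ⊔ o′) (ℓ ⊔ ℓ′) (e ⊔ e′)
C ×C D = record
  { Obj = C.Obj × D.Obj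
  ; _⇒_ = λ (A , B) (A′ , B′) → (A C.⇒ A′) × (B D.⇒ B′)
  ; _≈_ = λ (f , g) (f′ , g′) → (f C.≈ f′) × (g D.≈ g′)
  ; id  = C.id , D.id
  ; _∘_ = λ (f , g) (f′ , g′) → (f C.∘ f′) , (g D.∘ g′)
  ; isEquivalence = record
    { refl  = C.Equiv.refl , D.Equiv.refl
    ; sym   = λ (p , q) → C.Equiv.sym p , D.Equiv.sym q
    ; trans = λ (p , q) (p′ , q′) → C.Equiv.trans p p′ , D.Equiv.trans q q′
    }
  ; assoc     = C.assoc , D.assoc
  ; identityˡ = C.identityˡ , D.identityˡ
  ; identityʳ = C.identityʳ , D.identityʳ
  ; ∘-resp-≈  = λ (p , q) (p′ , q′) → C.∘-resp-≈ p p′ , D.∘-resp-≈ q q′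
  } where
    module C = Category C
    module D = Category D

π₁ : {C : Category o ℓ e} {D : Category o′ ℓ′ e′} → Functor (C ×C D) C
π₁ {C = C} = record
  { F₀ = proj₁
  ; F₁ = proj₁
  ; identity = Equiv.refl
  ; homomorphism = Equiv.refl
  ; F-resp-≈ = proj₁
  } where open Category C

π₂ : {C : Category o ℓ e} {D : Category o′ ℓ′ e′} → Functor (C ×C D) D
π₂ {D = D} = record
  { F₀ = proj₂
  ; F₁ = proj₂
  ; identity = Equiv.refl
  ; homomorphism = Equiv.refl
  ; F-resp-≈ = proj₂
  } where open Category D

infixr 6 _※_
_※_ : {B : Category o″ ℓ″ e″} {C : Category o ℓ e} {D : Category o′ ℓ′ e′} →
      Functor B C → Functor B D → Functor B (C ×C D)
F ※ G = record
  { F₀ = λ X → F.F₀ X , G.F₀ X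
  ; F₁ = λ f → F.F₁ f , G.F₁ f
  ; identity = F.identity , G.identity
  ; homomorphism = F.homomorphism , G.homomorphism
  ; F-resp-≈ = λ p → F.F-resp-≈ p , G.F-resp-≈ p
  } where
    module F = Functor F
    module G = Functor G

const : {C : Category o ℓ e} {D : Category o′ ℓ′ e′} → Category.Obj D → Functor C D
const {D = D} X = record
  { F₀ = λ _ → X
  ; F₁ = λ _ → id
  ; identity = Equiv.refl
  ; homomorphism = Equiv.sym identityˡ
  ; F-resp-≈ = λ _ → Equiv.refl
  } where open Category D

module _ {J : Category o′ ℓ′ e′} {C : Category o ℓ e} where
  private
    module J = Category J
    module C = Category C

  record Cocone (D : Functor J C) : Set (o ⊔ ℓ ⊔ e ⊔ o′ ⊔ ℓ′) where
    private module D = Functor D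
    field
      apex    : C.Obj
      ψ       : ∀ j → D.F₀ j C.⇒ apex
      commute : ∀ {i j} (f : i J.⇒ j) → ψ j C.∘ D.F₁ f C.≈ ψ i

  record IsColimit {D : Functor J C} (K : Cocone D) : Set (o ⊔ ℓ ⊔ e ⊔ o′ ⊔ ℓ′) where
    private module K = Cocone K
    field
      rep         : (L : Cocone D) → K.apex C.⇒ Cocone.apex L
      rep-commute : (L : Cocone D) → ∀ j → rep L C.∘ K.ψ j C.≈ Cocone.ψ L j
      rep-unique  : (L : Cocone D) (h : K.apex C.⇒ Cocone.apex L) →
                    (∀ j → h C.∘ K.ψ j C.≈ Cocone.ψ L j) → h C.≈ rep L

  record Colimit (D : Functor J C) : Set (o ⊔ ℓ ⊔ e ⊔ o′ ⊔ ℓ′) where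
    field
      cocone    : Cocone D
      isColimit : IsColimit cocone

mapCocone : {J : Category o″ ℓ″ e″} {C : Category o ℓ e} {D : Category o′ ℓ′ e′}
            (F : Functor C D) {G : Functor J C} → Cocone G → Cocone (F ∘F G)
mapCocone {D = D} F K = record
  { apex = F.F₀ K.apex
  ; ψ = λ j → F.F₁ (K.ψ j)
  ; commute = λ f → Equiv.trans (Equiv.sym F.homomorphism) (F.F-resp-≈ (K.commute f))
  } where
    open Category D
    module F = Functor F
    module K = Cocone K

PreservesColimits : (J : Category o″ ℓ″ e″) {C : Category o ℓ e} {D : Category o′ ℓ′ e′} →
                    Functor C D → Set (o ⊔ ℓ ⊔ e ⊔ o′ ⊔ ℓ′ ⊔ e′ ⊔ o″ ⊔ ℓ″ ⊔ e″)
PreservesColimits J {C} F =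
  {G : Functor J C} (K : Cocone G) → IsColimit K → IsColimit (mapCocone F K)

record Filtered (J : Category o ℓ e) : Set (o ⊔ ℓ ⊔ e) where
  open Category J
  field
    inhabitant : Obj
    bound      : ∀ i j → Σ[ k ∈ Obj ] (i ⇒ k) × (j ⇒ k)
    coequalise : ∀ {i j} (f g : i ⇒ j) → Σ[ k ∈ Obj ] Σ[ h ∈ j ⇒ k ] (h ∘ f ≈ h ∘ g)

-- "Small" means that objects, arrows and equality of arrows all live at
-- level s; the categories C below have arbitrary object level o but hom-setoids
-- at level s, i.e. they are locally small.

Cocomplete : Category o s s → Set (o ⊔ suc s)
Cocomplete {s = s} C = (J : Category s s s) (D : Functor J C) → Colimit D

Cocontinuous : {C : Category o s s} {D : Category o′ s s} → Functor C D → Set (o ⊔ o′ ⊔ suc s)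
Cocontinuous {s = s} F = (J : Category s s s) → PreservesColimits J F

Finitary : {C : Category o s s} {D : Category o′ s s} → Functor C D → Set (o ⊔ o′ ⊔ suc s)
Finitary {s = s} F = (J : Category s s s) → Filtered J → PreservesColimits J F

Setoids : ∀ s → Category (suc s) s s
Setoids s = record
  { Obj = Setoid s s
  ; _⇒_ = Func
  ; _≈_ = λ {A} {B} f g → ∀ x → Setoid._≈_ B (Func.to f x) (Func.to g x)
  ; id  = record { to = λ x → x ; cong = λ p → p }
  ; _∘_ = λ g f → record
    { to   = λ x → Func.to g (Func.to f x)
    ; cong = λ p → Func.cong g (Func.cong f p)
    }
  ; isEquivalence = λ {A} {B} → record
    { refl  = λ _ → Setoid.refl B
    ; sym   = λ p x → Setoid.sym B (p x)
    ; trans = λ p q x → Setoid.trans B (p x) (q x)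
    }
  ; assoc     = λ {_} {_} {_} {D} _ → Setoid.refl D
  ; identityˡ = λ {_} {B} _ → Setoid.refl B
  ; identityʳ = λ {_} {B} _ → Setoid.refl B
  ; ∘-resp-≈  = λ {_} {_} {C} {f} {h} {g} {i} p q x →
      Setoid.trans C (Func.cong f (q x)) (p (Func.to i x))
  }

Hom[_,-] : {C : Category o s s} → Category.Obj C → Functor C (Setoids s)
Hom[_,-] {C = C} A = record
  { F₀ = homSetoid A
  ; F₁ = λ f → record { to = f ∘_ ; cong = ∘-resp-≈ʳ }
  ; identity = λ _ → identityˡ
  ; homomorphism = λ _ → assoc
  ; F-resp-≈ = λ p _ → ∘-resp-≈ˡ p
  } where open Category C

FinitelyPresentable : (C : Category o s s) → Category.Obj C → Set (o ⊔ suc s)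
FinitelyPresentable C A = Finitary (Hom[_,-] {C = C} A)

record LocallyFinitelyPresentable (C : Category o s s) : Set (o ⊔ suc s) where
  open Category C
  field
    cocomplete : Cocomplete C
    Index      : Set s
    generator  : Index → Obj
    generator-presentable : ∀ i → FinitelyPresentable C (generator i)
    -- The objects of the diagram are generators only up to isomorphism, which
    -- avoids imposing equality of objects on D.
    filteredColimit : ∀ X →
      Σ[ J ∈ Category s s s ] Filtered J ×
      (Σ[ D ∈ Functor J C ]
         (∀ j → Σ[ i ∈ Index ] Functor.F₀ D j ≅ generator i) ×
         (Σ[ K ∈ Cocone D ] IsColimit K × Cocone.apex K ≡ X))

Discrete : Set s → Category s s s
Discrete A = record
  { Obj = A
  ; _⇒_ = _≡_
  ; _≈_ = _≡_
  ; id  = ≡.refl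
  ; _∘_ = λ q p → ≡.trans p q
  ; isEquivalence = ≡.isEquivalence
  ; assoc     = λ { {f = ≡.refl} → ≡.refl }
  ; identityˡ = λ { {f = ≡.refl} → ≡.refl }
  ; identityʳ = ≡.refl
  ; ∘-resp-≈  = λ { ≡.refl ≡.refl → ≡.refl }
  }

discreteDiagram : {A : Set s} (C : Category o s s) → (A → Category.Obj C) → Functor (Discrete A) C
discreteDiagram C X = record
  { F₀ = X
  ; F₁ = λ { ≡.refl → id }
  ; identity = Equiv.refl
  ; homomorphism = λ { {f = ≡.refl} {≡.refl} → Equiv.sym identityˡ }
  ; F-resp-≈ = λ { ≡.refl → Equiv.refl }
  } where open Category C

module FiniteCoproducts {C : Category o s s} (cocomplete : Cocomplete C) where
  open Category C

  private
    discreteCocone : {A : Set s} {X : A → Obj} (Y : Obj) → (∀ a → X a ⇒ Y) →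
                     Cocone (discreteDiagram C X)
    discreteCocone Y f = record
      { apex = Y ; ψ = f ; commute = λ { ≡.refl → identityʳ } }

    module ∅ = Colimit (cocomplete (Discrete ⊥) (discreteDiagram C λ ()))

    pick : Obj → Obj → Lift s Bool → Obj
    pick A B (lift true)  = A
    pick A B (lift false) = B

    module Sum (A B : Obj) where
      open Colimit (cocomplete (Discrete (Lift s Bool)) (discreteDiagram C (pick A B))) public
      open Cocone cocone public
      open IsColimit isColimit public

    sumCocone : ∀ {A B X} → A ⇒ X → B ⇒ X → Cocone (discreteDiagram C (pick A B))
    sumCocone f g = discreteCocone _ λ { (lift true) → f ; (lift false) → g }

  ∅ : Obj
  ∅ = Cocone.apex ∅.cocone

  ¡ : ∀ {X} → ∅ ⇒ X
  ¡ {X} = IsColimit.rep ∅.isColimit (discreteCocone X λ ())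

  ¡-unique : ∀ {X} (f : ∅ ⇒ X) → f ≈ ¡
  ¡-unique f = IsColimit.rep-unique ∅.isColimit _ f λ ()

  infixl 6 _+_ _+₁_ _+F_

  _+_ : Obj → Obj → Obj
  A + B = Sum.apex A B

  i₁ : ∀ {A B} → A ⇒ A + B
  i₁ {A} {B} = Sum.ψ A B (lift true)

  i₂ : ∀ {A B} → B ⇒ A + B
  i₂ {A} {B} = Sum.ψ A B (lift false)

  [_,_] : ∀ {A B X} → A ⇒ X → B ⇒ X → A + B ⇒ X
  [_,_] {A} {B} f g = Sum.rep A B (sumCocone f g)

  inject₁ : ∀ {A B X} {f : A ⇒ X} {g : B ⇒ X} → [ f , g ] ∘ i₁ ≈ f
  inject₁ {A} {B} {f = f} {g} = Sum.rep-commute A B (sumCocone f g) (lift true)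

  inject₂ : ∀ {A B X} {f : A ⇒ X} {g : B ⇒ X} → [ f , g ] ∘ i₂ ≈ g
  inject₂ {A} {B} {f = f} {g} = Sum.rep-commute A B (sumCocone f g) (lift false)

  []-unique : ∀ {A B X} {f : A ⇒ X} {g : B ⇒ X} {h : A + B ⇒ X} →
              h ∘ i₁ ≈ f → h ∘ i₂ ≈ g → h ≈ [ f , g ]
  []-unique {A} {B} {f = f} {g} {h} p q =
    Sum.rep-unique A B (sumCocone f g) h λ { (lift true) → p ; (lift false) → q }

  _+₁_ : ∀ {A A′ B B′} → A ⇒ A′ → B ⇒ B′ → A + B ⇒ A′ + B′
  f +₁ g = [ i₁ ∘ f , i₂ ∘ g ]

  _+F_ : {D : Category o′ ℓ′ e′} → Functor D C → Functor D C → Functor D C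
  F +F G = record
    { F₀ = λ X → F.F₀ X + G.F₀ X
    ; F₁ = λ f → F.F₁ f +₁ G.F₁ f
    ; identity = Equiv.sym ([]-unique
        (Equiv.trans identityˡ (Equiv.sym (Equiv.trans (∘-resp-≈ʳ F.identity) identityʳ)))
        (Equiv.trans identityˡ (Equiv.sym (Equiv.trans (∘-resp-≈ʳ G.identity) identityʳ))))
    ; homomorphism = Equiv.sym ([]-unique
        (Equiv.trans (Equiv.trans assoc (Equiv.trans (∘-resp-≈ʳ inject₁) (Equiv.trans (Equiv.sym assoc)
          (Equiv.trans (∘-resp-≈ˡ inject₁) assoc)))) (∘-resp-≈ʳ (Equiv.sym F.homomorphism)))
        (Equiv.trans (Equiv.trans assoc (Equiv.trans (∘-resp-≈ʳ inject₂) (Equiv.trans (Equiv.sym assoc)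
          (Equiv.trans (∘-resp-≈ˡ inject₂) assoc)))) (∘-resp-≈ʳ (Equiv.sym G.homomorphism))))
    ; F-resp-≈ = λ p → []-unique
        (Equiv.trans inject₁ (∘-resp-≈ʳ (F.F-resp-≈ p)))
        (Equiv.trans inject₂ (∘-resp-≈ʳ (G.F-resp-≈ p)))
    } where
      module F = Functor F
      module G = Functor G

record Monad (C : Category o ℓ e) : Set (o ⊔ ℓ ⊔ e) where
  open Category C
  field
    functor : Endofunctor C
    unit    : NaturalTransformation Id functor
    mult    : NaturalTransformation (functor ∘F functor) functor
  module unit = NaturalTransformation unit
  module mult = NaturalTransformation mult
  open Functor functor public
  open NaturalTransformation unit public using (η)
  open NaturalTransformation mult public renaming (η to μ) hiding (commute)
  field
    μ-assoc     : ∀ {X} → μ X ∘ F₁ (μ X) ≈ μ X ∘ μ (F₀ X)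
    μ-identityˡ : ∀ {X} → μ X ∘ F₁ (η X) ≈ id
    μ-identityʳ : ∀ {X} → μ X ∘ η (F₀ X) ≈ id

record MonadMorphism {C : Category o ℓ e} (R R′ : Monad C) : Set (o ⊔ ℓ ⊔ e) where
  private
    module R  = Monad R
    module R′ = Monad R′
  open Category C
  field
    nat : NaturalTransformation R.functor R′.functor
  open NaturalTransformation nat public renaming (η to α)
  field
    unit-commute : ∀ {X} → α X ∘ R.η X ≈ R′.η X
    mult-commute : ∀ {X} → α X ∘ R.μ X ≈ R′.μ X ∘ (R′.F₁ (α X) ∘ α (R.F₀ X))

-- Freeness is the universal property among monads: a universal arrow from F to
-- the forgetful functor from monads to endofunctors.  Algebraic freeness (monad
-- algebras being F-algebras) is not part of the definition.
record FreeMonad {C : Category o ℓ e} (F : Endofunctor C) : Set (o ⊔ ℓ ⊔ e) where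
  open Category C
  field
    monad     : Monad C
    inclusion : NaturalTransformation F (Monad.functor monad)
  open Monad monad public
  module inclusion = NaturalTransformation inclusion
  open NaturalTransformation inclusion public renaming (η to ηF) hiding (commute)
  field
    extension : (M : Monad C) → NaturalTransformation F (Monad.functor M) → MonadMorphism monad M
    extension-commute : (M : Monad C) (θ : NaturalTransformation F (Monad.functor M)) → ∀ X →
      MonadMorphism.α (extension M θ) X ∘ ηF X ≈ NaturalTransformation.η θ X
    extension-unique  : (M : Monad C) (θ : NaturalTransformation F (Monad.functor M))
      (φ : MonadMorphism monad M) →
      (∀ X → MonadMorphism.α φ X ∘ ηF X ≈ NaturalTransformation.η θ X) →
      ∀ X → MonadMorphism.α φ X ≈ MonadMorphism.α (extension M θ) X

record DistributiveLaw {C : Category o ℓ e} (T S : Monad C) : Set (o ⊔ ℓ ⊔ e) where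
  private
    module T = Monad T
    module S = Monad S
  open Category C
  field
    law : NaturalTransformation (T.functor ∘F S.functor) (S.functor ∘F T.functor)
  open NaturalTransformation law public renaming (η to δ)
  field
    unit-T : ∀ {X} → δ X ∘ T.η (S.F₀ X) ≈ S.F₁ (T.η X)
    unit-S : ∀ {X} → δ X ∘ T.F₁ (S.η X) ≈ S.η (T.F₀ X)
    mult-T : ∀ {X} → δ X ∘ T.μ (S.F₀ X) ≈ S.F₁ (T.μ X) ∘ (δ (T.F₀ X) ∘ T.F₁ (δ X))
    mult-S : ∀ {X} → δ X ∘ T.F₁ (S.μ X) ≈ S.μ (T.F₀ X) ∘ (S.F₁ (δ X) ∘ δ (S.F₀ X))

module _ {C : Category o ℓ e} {T S : Monad C} (Δ : DistributiveLaw T S) where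
  private
    module T = Monad T
    module S = Monad S
  open Category C
  open DistributiveLaw Δ
  open HomReasoning

  private
    ST : Endofunctor C
    ST = S.functor ∘F T.functor
    module ST = Functor ST

    m : ∀ X → ST.F₀ (ST.F₀ X) ⇒ ST.F₀ X
    m X = S.F₁ (T.μ X) ∘ (S.μ (T.F₀ (T.F₀ X)) ∘ S.F₁ (δ (T.F₀ X)))

    u : ∀ X → X ⇒ ST.F₀ X
    u X = S.F₁ (T.η X) ∘ S.η X

    S-∘ : ∀ {A B D E} {f : B ⇒ D} {g : A ⇒ B} {k : E ⇒ S.F₀ A} →
          S.F₁ (f ∘ g) ∘ k ≈ S.F₁ f ∘ (S.F₁ g ∘ k)
    S-∘ = Equiv.trans (∘-resp-≈ˡ S.homomorphism) assoc

  composite : Monad C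
  composite = record
    { functor = ST
    ; unit = record
      { η = u
      ; commute = λ {X} {Y} f → begin
          (S.F₁ (T.η Y) ∘ S.η Y) ∘ f           ≈⟨ assoc ⟩
          S.F₁ (T.η Y) ∘ (S.η Y ∘ f)           ≈⟨ ∘-resp-≈ʳ (S.unit.commute f) ⟩
          S.F₁ (T.η Y) ∘ (S.F₁ f ∘ S.η X)      ≈⟨ extend (S.square (T.unit.commute f)) ⟩
          S.F₁ (T.F₁ f) ∘ (S.F₁ (T.η X) ∘ S.η X) ∎
      }
    ; mult = record
      { η = m
      ; commute = λ {X} {Y} f → begin
          m Y ∘ ST.F₁ (ST.F₁ f)
            ≈⟨ assoc ⟩
          S.F₁ (T.μ Y) ∘ ((S.μ _ ∘ S.F₁ (δ (T.F₀ Y))) ∘ ST.F₁ (ST.F₁ f))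
            ≈⟨ ∘-resp-≈ʳ assoc ⟩
          S.F₁ (T.μ Y) ∘ (S.μ _ ∘ (S.F₁ (δ (T.F₀ Y)) ∘ ST.F₁ (ST.F₁ f)))
            ≈⟨ ∘-resp-≈ʳ (∘-resp-≈ʳ (S.square (commute (T.F₁ f)))) ⟩
          S.F₁ (T.μ Y) ∘ (S.μ _ ∘ (S.F₁ (S.F₁ (T.F₁ (T.F₁ f))) ∘ S.F₁ (δ (T.F₀ X))))
            ≈⟨ ∘-resp-≈ʳ (extend (S.mult.commute (T.F₁ (T.F₁ f)))) ⟩
          S.F₁ (T.μ Y) ∘ (S.F₁ (T.F₁ (T.F₁ f)) ∘ (S.μ _ ∘ S.F₁ (δ (T.F₀ X))))
            ≈⟨ extend (S.square (T.mult.commute f)) ⟩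
          ST.F₁ f ∘ m X ∎
      }
    ; μ-assoc = λ {X} → begin
        m X ∘ ST.F₁ (m X)
          ≈⟨ Equiv.trans assoc (∘-resp-≈ʳ assoc) ⟩
        S.F₁ (T.μ X) ∘ (S.μ _ ∘ (S.F₁ (δ (T.F₀ X)) ∘ ST.F₁ (m X)))
          ≈⟨ ∘-resp-≈ʳ (∘-resp-≈ʳ (Equiv.trans (Equiv.sym S.homomorphism) (S.F-resp-≈ δ-m))) ⟩
        S.F₁ (T.μ X) ∘ (S.μ _ ∘ S.F₁ (S.F₁ (T.F₁ (T.μ X)) ∘ (S.μ _ ∘ r X)))
          ≈⟨ ∘-resp-≈ʳ (∘-resp-≈ʳ (Equiv.trans S.homomorphism (∘-resp-≈ʳ S.homomorphism))) ⟩
        S.F₁ (T.μ X) ∘ (S.μ _ ∘ (S.F₁ (S.F₁ (T.F₁ (T.μ X))) ∘ (S.F₁ (S.μ _) ∘ S.F₁ (r X))))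
          ≈⟨ ∘-resp-≈ʳ (extend (S.mult.commute (T.F₁ (T.μ X)))) ⟩
        S.F₁ (T.μ X) ∘ (S.F₁ (T.F₁ (T.μ X)) ∘ (S.μ _ ∘ (S.F₁ (S.μ _) ∘ S.F₁ (r X))))
          ≈⟨ extend (S.square T.μ-assoc) ⟩
        S.F₁ (T.μ X) ∘ (S.F₁ (T.μ (T.F₀ X)) ∘ (S.μ _ ∘ (S.F₁ (S.μ _) ∘ S.F₁ (r X))))
          ≈⟨ ∘-resp-≈ʳ (∘-resp-≈ʳ (extend S.μ-assoc)) ⟩
        S.F₁ (T.μ X) ∘ (S.F₁ (T.μ (T.F₀ X)) ∘ (S.μ _ ∘ (S.μ _ ∘ S.F₁ (r X))))
          ≈⟨ ∘-resp-≈ʳ (∘-resp-≈ʳ (∘-resp-≈ʳ (∘-resp-≈ʳ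
               (Equiv.trans S.homomorphism (∘-resp-≈ʳ S.homomorphism))))) ⟩
        S.F₁ (T.μ X) ∘ (S.F₁ (T.μ (T.F₀ X)) ∘ (S.μ _ ∘ (S.μ _ ∘
          (S.F₁ (S.F₁ (δ _)) ∘ (S.F₁ (S.F₁ (T.F₁ (δ _))) ∘ S.F₁ (δ _))))))
          ≈⟨ ∘-resp-≈ʳ (∘-resp-≈ʳ (∘-resp-≈ʳ (extend (S.mult.commute (δ _))))) ⟩
        S.F₁ (T.μ X) ∘ (S.F₁ (T.μ (T.F₀ X)) ∘ (S.μ _ ∘ (S.F₁ (δ _) ∘ (S.μ _ ∘
          (S.F₁ (S.F₁ (T.F₁ (δ _))) ∘ S.F₁ (δ _))))))
          ≈⟨ ∘-resp-≈ʳ (∘-resp-≈ʳ (∘-resp-≈ʳ (∘-resp-≈ʳ (extend (S.mult.commute (T.F₁ (δ _))))))) ⟩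
        S.F₁ (T.μ X) ∘ (S.F₁ (T.μ (T.F₀ X)) ∘ (S.μ _ ∘ (S.F₁ (δ _) ∘ (S.F₁ (T.F₁ (δ _)) ∘
          (S.μ _ ∘ S.F₁ (δ _))))))
          ≈⟨ ∘-resp-≈ʳ (extend (S.mult.commute (T.μ (T.F₀ X)))) ⟨
        S.F₁ (T.μ X) ∘ (S.μ _ ∘ (S.F₁ (S.F₁ (T.μ (T.F₀ X))) ∘ (S.F₁ (δ _) ∘ (S.F₁ (T.F₁ (δ _)) ∘
          (S.μ _ ∘ S.F₁ (δ _))))))
          ≈⟨ ∘-resp-≈ʳ (∘-resp-≈ʳ (Equiv.trans S-∘ (∘-resp-≈ʳ S-∘))) ⟨
        S.F₁ (T.μ X) ∘ (S.μ _ ∘ (S.F₁ (S.F₁ (T.μ (T.F₀ X)) ∘ (δ _ ∘ T.F₁ (δ _))) ∘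
          (S.μ _ ∘ S.F₁ (δ _))))
          ≈⟨ ∘-resp-≈ʳ (∘-resp-≈ʳ (∘-resp-≈ˡ (S.F-resp-≈ mult-T))) ⟨
        S.F₁ (T.μ X) ∘ (S.μ _ ∘ (S.F₁ (δ (T.F₀ X) ∘ T.μ (ST.F₀ X)) ∘ (S.μ _ ∘ S.F₁ (δ _))))
          ≈⟨ ∘-resp-≈ʳ (∘-resp-≈ʳ S-∘) ⟩
        S.F₁ (T.μ X) ∘ (S.μ _ ∘ (S.F₁ (δ (T.F₀ X)) ∘ m (ST.F₀ X)))
          ≈⟨ Equiv.trans assoc (∘-resp-≈ʳ assoc) ⟨
        m X ∘ m (ST.F₀ X) ∎
    ; μ-identityˡ = λ {X} → begin
        m X ∘ ST.F₁ (u X)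
          ≈⟨ Equiv.trans assoc (∘-resp-≈ʳ assoc) ⟩
        S.F₁ (T.μ X) ∘ (S.μ _ ∘ (S.F₁ (δ (T.F₀ X)) ∘ ST.F₁ (u X)))
          ≈⟨ ∘-resp-≈ʳ (∘-resp-≈ʳ (S.square δ-u)) ⟩
        S.F₁ (T.μ X) ∘ (S.μ _ ∘ (S.F₁ (S.η _) ∘ S.F₁ (T.F₁ (T.η X))))
          ≈⟨ ∘-resp-≈ʳ (cancel S.μ-identityˡ) ⟩
        S.F₁ (T.μ X) ∘ S.F₁ (T.F₁ (T.η X))
          ≈⟨ S.homomorphism ⟨
        S.F₁ (T.μ X ∘ T.F₁ (T.η X))
          ≈⟨ S.F-resp-≈ T.μ-identityˡ ⟩
        S.F₁ id
          ≈⟨ S.identity ⟩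
        id ∎
    ; μ-identityʳ = λ {X} → begin
        m X ∘ u (ST.F₀ X)
          ≈⟨ Equiv.trans assoc (∘-resp-≈ʳ assoc) ⟩
        S.F₁ (T.μ X) ∘ (S.μ _ ∘ (S.F₁ (δ (T.F₀ X)) ∘ (S.F₁ (T.η _) ∘ S.η _)))
          ≈⟨ ∘-resp-≈ʳ (∘-resp-≈ʳ S-∘) ⟨
        S.F₁ (T.μ X) ∘ (S.μ _ ∘ (S.F₁ (δ (T.F₀ X) ∘ T.η _) ∘ S.η _))
          ≈⟨ ∘-resp-≈ʳ (∘-resp-≈ʳ (∘-resp-≈ˡ (S.F-resp-≈ unit-T))) ⟩
        S.F₁ (T.μ X) ∘ (S.μ _ ∘ (S.F₁ (S.F₁ (T.η (T.F₀ X))) ∘ S.η _))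
          ≈⟨ ∘-resp-≈ʳ (extend (S.mult.commute (T.η (T.F₀ X)))) ⟩
        S.F₁ (T.μ X) ∘ (S.F₁ (T.η (T.F₀ X)) ∘ (S.μ _ ∘ S.η _))
          ≈⟨ ∘-resp-≈ʳ (Equiv.trans (∘-resp-≈ʳ S.μ-identityʳ) identityʳ) ⟩
        S.F₁ (T.μ X) ∘ S.F₁ (T.η (T.F₀ X))
          ≈⟨ S.homomorphism ⟨
        S.F₁ (T.μ X ∘ T.η (T.F₀ X))
          ≈⟨ S.F-resp-≈ T.μ-identityʳ ⟩
        S.F₁ id
          ≈⟨ S.identity ⟩
        id ∎
    } where
      r : ∀ X → T.F₀ (ST.F₀ (ST.F₀ X)) ⇒ S.F₀ (S.F₀ (T.F₀ (T.F₀ (T.F₀ X))))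
      r X = S.F₁ (δ (T.F₀ (T.F₀ X))) ∘ (S.F₁ (T.F₁ (δ (T.F₀ X))) ∘ δ (T.F₀ (ST.F₀ X)))

      δ-m : ∀ {X} → δ (T.F₀ X) ∘ T.F₁ (m X) ≈ S.F₁ (T.F₁ (T.μ X)) ∘ (S.μ _ ∘ r X)
      δ-m {X} = begin
        δ (T.F₀ X) ∘ T.F₁ (m X)
          ≈⟨ ∘-resp-≈ʳ (Equiv.trans T.homomorphism (∘-resp-≈ʳ T.homomorphism)) ⟩
        δ (T.F₀ X) ∘ (T.F₁ (S.F₁ (T.μ X)) ∘ (T.F₁ (S.μ _) ∘ T.F₁ (S.F₁ (δ (T.F₀ X)))))
          ≈⟨ extend (commute (T.μ X)) ⟩
        S.F₁ (T.F₁ (T.μ X)) ∘ (δ _ ∘ (T.F₁ (S.μ _) ∘ T.F₁ (S.F₁ (δ (T.F₀ X)))))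
          ≈⟨ ∘-resp-≈ʳ (extend mult-S) ⟩
        S.F₁ (T.F₁ (T.μ X)) ∘ (S.μ _ ∘ ((S.F₁ (δ _) ∘ δ _) ∘ T.F₁ (S.F₁ (δ (T.F₀ X)))))
          ≈⟨ ∘-resp-≈ʳ (∘-resp-≈ʳ (Equiv.trans assoc (∘-resp-≈ʳ (commute (δ (T.F₀ X)))))) ⟩
        S.F₁ (T.F₁ (T.μ X)) ∘ (S.μ _ ∘ r X) ∎

      δ-u : ∀ {X} → δ (T.F₀ X) ∘ T.F₁ (u X) ≈ S.η _ ∘ T.F₁ (T.η X)
      δ-u {X} = begin
        δ (T.F₀ X) ∘ T.F₁ (u X)
          ≈⟨ ∘-resp-≈ʳ T.homomorphism ⟩
        δ (T.F₀ X) ∘ (T.F₁ (S.F₁ (T.η X)) ∘ T.F₁ (S.η X))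
          ≈⟨ extend (commute (T.η X)) ⟩
        S.F₁ (T.F₁ (T.η X)) ∘ (δ X ∘ T.F₁ (S.η X))
          ≈⟨ ∘-resp-≈ʳ unit-S ⟩
        S.F₁ (T.F₁ (T.η X)) ∘ S.η _
          ≈⟨ S.unit.commute (T.F₁ (T.η X)) ⟨
        S.η _ ∘ T.F₁ (T.η X) ∎

  Sη : MonadMorphism S composite
  Sη = record
    { nat = record
      { η = λ X → S.F₁ (T.η X)
      ; commute = λ f → S.square (T.unit.commute f)
      }
    ; unit-commute = Equiv.refl
    ; mult-commute = λ {X} → Equiv.sym (begin
        m X ∘ (ST.F₁ (S.F₁ (T.η X)) ∘ S.F₁ (T.η (S.F₀ X)))
          ≈⟨ Equiv.trans assoc (∘-resp-≈ʳ assoc) ⟩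
        S.F₁ (T.μ X) ∘ (S.μ _ ∘ (S.F₁ (δ (T.F₀ X)) ∘ (ST.F₁ (S.F₁ (T.η X)) ∘ S.F₁ (T.η (S.F₀ X)))))
          ≈⟨ ∘-resp-≈ʳ (∘-resp-≈ʳ (∘-resp-≈ʳ (S.square (T.unit.commute (S.F₁ (T.η X)))))) ⟨
        S.F₁ (T.μ X) ∘ (S.μ _ ∘ (S.F₁ (δ (T.F₀ X)) ∘ (S.F₁ (T.η _) ∘ S.F₁ (S.F₁ (T.η X)))))
          ≈⟨ ∘-resp-≈ʳ (∘-resp-≈ʳ S-∘) ⟨
        S.F₁ (T.μ X) ∘ (S.μ _ ∘ (S.F₁ (δ (T.F₀ X) ∘ T.η _) ∘ S.F₁ (S.F₁ (T.η X))))
          ≈⟨ ∘-resp-≈ʳ (∘-resp-≈ʳ (∘-resp-≈ˡ (S.F-resp-≈ unit-T))) ⟩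
        S.F₁ (T.μ X) ∘ (S.μ _ ∘ (S.F₁ (S.F₁ (T.η (T.F₀ X))) ∘ S.F₁ (S.F₁ (T.η X))))
          ≈⟨ ∘-resp-≈ʳ (extend (S.mult.commute (T.η (T.F₀ X)))) ⟩
        S.F₁ (T.μ X) ∘ (S.F₁ (T.η (T.F₀ X)) ∘ (S.μ _ ∘ S.F₁ (S.F₁ (T.η X))))
          ≈⟨ cancel (Equiv.trans (Equiv.sym S.homomorphism)
                       (Equiv.trans (S.F-resp-≈ T.μ-identityʳ) S.identity)) ⟩
        S.μ _ ∘ S.F₁ (S.F₁ (T.η X))
          ≈⟨ S.mult.commute (T.η X) ⟩
        S.F₁ (T.η X) ∘ S.μ X ∎)
    }

module _ {C : Category o s s} (lfp : LocallyFinitelyPresentable C) where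
  open Category C
  open LocallyFinitelyPresentable lfp
  open FiniteCoproducts cocomplete

  ConstantFree : Monad C → Set s
  ConstantFree T = IsIso (Monad.η T ∅)

  Admissible : {R R′ : Monad C} → MonadMorphism R R′ → Set s
  Admissible α = IsIso (MonadMorphism.α α ∅)

  -- Sig stands for the functor usually written Σ, and S for its free monad.
  record SimpleStructuralLaw : Set (o ⊔ suc s) where
    field
      Sig          : Endofunctor C
      Sig-finitary : Finitary Sig
      Γ            : Functor (C ×C C) C
      Γ-cocontinuous₁ : ∀ Y → Cocontinuous (Γ ∘F (Id ※ const Y))
      Γ-finitary₂     : ∀ X → Finitary (Γ ∘F (const X ※ Id))
      Sig*         : FreeMonad Sig

    module S = FreeMonad Sig*

    field
      d : NaturalTransformation
            (Γ ∘F ((Sig ∘F π₁) ※ π₂))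
            (S.functor ∘F (Γ ∘F (π₁ ※ (S.functor ∘F π₂)) +F π₁ +F π₂))

    module Sig = Functor Sig
    module Γ   = Functor Γ
    module d   = NaturalTransformation d

    ΓSΔ : Endofunctor C
    ΓSΔ = Γ ∘F (Id ※ S.functor)

-- The universal property of a free monad on a functor F preserving ω-colimits makes it
-- isomorphic to the monad of colimits of X → X + F X → …, so that M X is the free F-algebra
-- on X.  A distributive law TS → ST thus amounts to a lifting of the monad S to algebras for
-- G X = Γ(X , S X).  Given a : Γ(A , S A) → A, a map act a : Γ(S A , S A) → S A is defined by
-- recursion on the first argument, using cocontinuity of Γ there: on A it is a, and on Σ(S A)
-- it is given by d.  Precomposing with Γ(S A , μ) gives the lifted algebra, and the laws
-- follow from the uniqueness of iterates.

module Submission where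

open import Defs
open import Level using (Level; _⊔_; Lift; lift) renaming (suc to lsuc)
open import Data.Bool.Base using (Bool; true; false)
open import Data.Empty using (⊥-elim)
open import Data.Empty.Polymorphic using (⊥)
open import Data.Nat.Base as ℕ using (ℕ; zero; suc)
open import Data.Nat.Properties using (+-comm; +-suc; 1+n≰n; m≤n⇒m≤1+n; ≤-refl)
open import Data.Product.Base using (Σ-syntax; _×_; _,_)
open import Relation.Binary.PropositionalEquality as ≡ using (_≡_)

-- The freeness of `Sig*` and `T*` speaks of monads only, whereas every recursion below needs `S X`
-- and `T X` to be free as algebras. Hence each free monad is compared with one built from chains,
-- which requires its functor to preserve ω-colimits. For `ΓSΔ` this is no hypothesis: it rests on
-- `S` preserving them, which is itself deduced from algebraic freeness of `S`. The lifted algebra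
-- is not defined by direct recursion, because `d` turns the second argument Y into S Y and so each
-- unfolding would change it. With Y = S A the new S Y is folded back by μ, and the second argument
-- stays fixed while the first is consumed. An ordinary fold does not fit either: the domain is Γ(S
-- A , S A) rather than S A, and `d` also returns its first argument unprocessed. This is why
-- iteration is set up out of Q A for cocontinuous Q, here Q = Γ(- , S A). Constant-freeness has the
-- same source: Γ(- , S ∅) preserves the empty colimit, so ∅ carries exactly one algebra structure
-- and is free on itself.

private
  variable
    o ℓ e s : Level

-- The ordinal ω as a small filtered category.

-- The order m ≤ n, placed at level s so that ω is small. Successors are added at the upper end, so
-- that a path into a chain is extended by composing with one more map of the chain.
data Reach (s : Level) (m : ℕ) : ℕ → Set s where
  here : Reach s m m
  next : ∀ {n} → Reach s m n → Reach s m (suc n)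

_⨾_ : ∀ {k m n} → Reach s k m → Reach s m n → Reach s k n
p ⨾ here   = p
p ⨾ next q = next (p ⨾ q)

⨾-assoc : ∀ {j k m n} (p : Reach s j k) (q : Reach s k m) (r : Reach s m n) →
          (p ⨾ q) ⨾ r ≡ p ⨾ (q ⨾ r)
⨾-assoc p q here     = ≡.refl
⨾-assoc p q (next r) = ≡.cong next (⨾-assoc p q r)

⨾-identityˡ : ∀ {m n} (p : Reach s m n) → here ⨾ p ≡ p
⨾-identityˡ here     = ≡.refl
⨾-identityˡ (next p) = ≡.cong next (⨾-identityˡ p)

Reach⇒≤ : ∀ {m n} → Reach s m n → m ℕ.≤ n
Reach⇒≤ here     = ≤-refl
Reach⇒≤ (next p) = m≤n⇒m≤1+n (Reach⇒≤ p)

-- The mixed cases would give 1 + n ≤ n. Since ω is thus thin, parallel arrows are already equal and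
-- filteredness reduces to upper bounds.
Reach-irrelevant : ∀ {m n} (p q : Reach s m n) → p ≡ q
Reach-irrelevant here     here     = ≡.refl
Reach-irrelevant here     (next q) = ⊥-elim (1+n≰n (Reach⇒≤ q))
Reach-irrelevant (next p) here     = ⊥-elim (1+n≰n (Reach⇒≤ p))
Reach-irrelevant (next p) (next q) = ≡.cong next (Reach-irrelevant p q)

Reach-+ʳ : ∀ m n → Reach s n (m ℕ.+ n)
Reach-+ʳ zero    n = here
Reach-+ʳ (suc m) n = next (Reach-+ʳ m n)

Reach-+ˡ : ∀ m n → Reach s m (m ℕ.+ n)
Reach-+ˡ m n = ≡.subst (Reach _ m) (+-comm n m) (Reach-+ʳ n m)

ω : ∀ s → Category s s s
ω s = record
  { Obj = Lift s ℕ
  ; _⇒_ = λ (lift m) (lift n) → Reach s m n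
  ; _≈_ = _≡_
  ; id  = here
  ; _∘_ = λ q p → p ⨾ q
  ; isEquivalence = ≡.isEquivalence
  ; assoc     = λ {_} {_} {_} {_} {f} {g} {h} → ≡.sym (⨾-assoc f g h)
  ; identityˡ = ≡.refl
  ; identityʳ = λ {_} {_} {f} → ⨾-identityˡ f
  ; ∘-resp-≈  = λ { ≡.refl ≡.refl → ≡.refl }
  }

ω-filtered : Filtered (ω s)
ω-filtered = record
  { inhabitant = lift zero
  ; bound      = λ (lift m) (lift n) → lift (m ℕ.+ n) , Reach-+ˡ m n , Reach-+ʳ m n
  ; coequalise = λ f g → _ , here , Reach-irrelevant f g
  }

module Composites (C : Category o ℓ e) where
  open Category C

  pullˡ : ∀ {A B D E} {f : D ⇒ E} {g : B ⇒ D} {h : B ⇒ E} {k : A ⇒ B} →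
          f ∘ g ≈ h → f ∘ (g ∘ k) ≈ h ∘ k
  pullˡ p = Equiv.trans (Equiv.sym assoc) (∘-resp-≈ˡ p)

  pullʳ : ∀ {A B D E} {f : D ⇒ E} {g : B ⇒ D} {h : A ⇒ D} {k : A ⇒ B} →
          g ∘ k ≈ h → (f ∘ g) ∘ k ≈ f ∘ h
  pullʳ p = Equiv.trans assoc (∘-resp-≈ʳ p)

-- Colimits of ω-chains, in one and in two variables.

module SequentialColimits (C : Category o s s) where
  open Category C
  open HomReasoning
  open Composites C

  record Chain : Set (o ⊔ s) where
    field
      X : ℕ → Obj
      x : ∀ n → X n ⇒ X (suc n)

    to : ∀ {m n} → Reach s m n → X m ⇒ X n
    to here     = id
    to (next p) = x _ ∘ to p

    to-⨾ : ∀ {k m n} (p : Reach s k m) (q : Reach s m n) → to (p ⨾ q) ≈ to q ∘ to p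
    to-⨾ p here     = Equiv.sym identityˡ
    to-⨾ p (next q) = Equiv.trans (∘-resp-≈ʳ (to-⨾ p q)) (Equiv.sym assoc)

    to-irrelevant : ∀ {m n} (p q : Reach s m n) → to p ≈ to q
    to-irrelevant p q with ≡.refl ← Reach-irrelevant p q = Equiv.refl

    functor : Functor (ω s) C
    functor = record
      { F₀ = λ (lift n) → X n
      ; F₁ = to
      ; identity     = Equiv.refl
      ; homomorphism = λ {_} {_} {_} {f} {g} → to-⨾ f g
      ; F-resp-≈     = λ { ≡.refl → Equiv.refl }
      }

  -- Only consecutive maps are mentioned, and uniqueness is stated as joint epimorphy of the legs
  -- (`rep-ext`), the form in which it is applied.
  record IsSeqColimit (D : Chain) {A : Obj} (ι : ∀ n → Chain.X D n ⇒ A) : Set (o ⊔ s) where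
    open Chain D
    field
      ι-commute   : ∀ n → ι (suc n) ∘ x n ≈ ι n
      rep         : ∀ {L} (c : ∀ n → X n ⇒ L) → (∀ n → c (suc n) ∘ x n ≈ c n) → A ⇒ L
      rep-commute : ∀ {L} (c : ∀ n → X n ⇒ L) (p : ∀ n → c (suc n) ∘ x n ≈ c n) →
                    ∀ n → rep c p ∘ ι n ≈ c n
      rep-ext     : ∀ {L} {f g : A ⇒ L} → (∀ n → f ∘ ι n ≈ g ∘ ι n) → f ≈ g

  mapChain : Endofunctor C → Chain → Chain
  mapChain F D = record { X = λ n → F.F₀ (D.X n) ; x = λ n → F.F₁ (D.x n) }
    where
      module F = Functor F
      module D = Chain D

  PreservesSeqColimits : Endofunctor C → Set (o ⊔ s)
  PreservesSeqColimits F = ∀ {D A} {ι : ∀ n → Chain.X D n ⇒ A} → IsSeqColimit D ι →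
    IsSeqColimit (mapChain F D) (λ n → Functor.F₁ F (ι n))

  -- Induction on the path extends compatibility from consecutive maps to all of ω. The parameter F
  -- covers a chain (F = `Id`) and its image under a functor at once.
  to-commute : (D : Chain) (F : Endofunctor C) →
    let open Chain D
        open Functor F
    in ∀ {L} (c : ∀ n → F₀ (X n) ⇒ L) → (∀ n → c (suc n) ∘ F₁ (x n) ≈ c n) →
    ∀ {m n} (p : Reach s m n) → c n ∘ F₁ (to p) ≈ c m
  to-commute D F c q here = Equiv.trans (∘-resp-≈ʳ (Functor.identity F)) identityʳ
  to-commute D F c q {m} (next {n} p) = begin
    c (suc n) ∘ F₁ (x n ∘ to p)      ≈⟨ ∘-resp-≈ʳ homomorphism ⟩
    c (suc n) ∘ (F₁ (x n) ∘ F₁ (to p)) ≈⟨ pullˡ (q n) ⟩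
    c n ∘ F₁ (to p)                  ≈⟨ to-commute D F c q p ⟩
    c m                              ∎
    where
      open Chain D
      open Functor F

  seqCocone : (D : Chain) (F : Endofunctor C) →
    let open Chain D
        open Functor F using (F₀; F₁)
    in ∀ {L} (c : ∀ n → F₀ (X n) ⇒ L) → (∀ n → c (suc n) ∘ F₁ (x n) ≈ c n) →
    Cocone (F ∘F functor)
  seqCocone D F {L} c q = record
    { apex    = L
    ; ψ       = λ (lift n) → c n
    ; commute = to-commute D F c q
    }

  -- Kept apart from `seqCocone D Id`: the functors `Id ∘F functor` and `functor` differ in their
  -- proof fields, so their cocones have different types.
  seqCoconeOf : (D : Chain) → let open Chain D in ∀ {L} (c : ∀ n → X n ⇒ L) →
    (∀ n → c (suc n) ∘ x n ≈ c n) → Cocone functor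
  seqCoconeOf D {L} c q = record
    { apex    = L
    ; ψ       = λ (lift n) → c n
    ; commute = to-commute D Id c q
    }

  isSeqColimit⇒isColimit : ∀ {D A} {ι : ∀ n → Chain.X D n ⇒ A} (K : IsSeqColimit D ι) →
    IsColimit (seqCoconeOf D ι (IsSeqColimit.ι-commute K))
  isSeqColimit⇒isColimit {D} K = record
    { rep         = λ L → rep (ψ L) (link L)
    ; rep-commute = λ L (lift n) → rep-commute (ψ L) (link L) n
    ; rep-unique  = λ L h p → rep-ext λ n →
        Equiv.trans (p (lift n)) (Equiv.sym (rep-commute (ψ L) (link L) n))
    }
    where
      open IsSeqColimit K
      open Chain D
      ψ : (L : Cocone functor) → ∀ n → X n ⇒ Cocone.apex L
      ψ L n = Cocone.ψ L (lift n)
      link : (L : Cocone functor) → ∀ n → ψ L (suc n) ∘ x n ≈ ψ L n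
      -- The arrow `next here` acts as `x n ∘ id`, not as `x n`.
      link L n = Equiv.trans (∘-resp-≈ʳ (Equiv.sym identityʳ)) (Cocone.commute L (next here))

  isColimit⇒isSeqColimit : (D : Chain) (F : Endofunctor C) (K : Cocone (F ∘F Chain.functor D)) →
    IsColimit K → IsSeqColimit (mapChain F D) (λ n → Cocone.ψ K (lift n))
  isColimit⇒isSeqColimit D F K isColimit = record
    { ι-commute   = λ n → Equiv.trans (∘-resp-≈ʳ (F.F-resp-≈ (Equiv.sym identityʳ)))
                                      (Cocone.commute K (next here))
    ; rep         = λ c p → rep (seqCocone D F c p)
    ; rep-commute = λ c p n → rep-commute (seqCocone D F c p) (lift n)
    ; rep-ext     = λ {L} {f} {g} p →
        let c = seqCocone D F (λ n → g ∘ Cocone.ψ K (lift n)) (λ n → pullʳ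
                  (Equiv.trans (∘-resp-≈ʳ (F.F-resp-≈ (Equiv.sym identityʳ)))
                               (Cocone.commute K (next here))))
        in Equiv.trans (rep-unique c f (λ (lift n) → p n))
                       (Equiv.sym (rep-unique c g (λ _ → Equiv.refl)))
    }
    where
      open IsColimit isColimit
      module F = Functor F

  finitary⇒preservesSeq : {F : Endofunctor C} → Finitary F → PreservesSeqColimits F
  finitary⇒preservesSeq {F} finitary {D} K =
    isColimit⇒isSeqColimit D F _ (finitary (ω s) ω-filtered _ (isSeqColimit⇒isColimit K))

  record SeqColimit (D : Chain) : Set (o ⊔ s) where
    open Chain D
    field
      {apex}       : Obj
      ι            : ∀ n → X n ⇒ apex
      isSeqColimit : IsSeqColimit D ι
    open IsSeqColimit isSeqColimit public

  seqColimit : Cocomplete C → (D : Chain) → SeqColimit D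
  seqColimit cocomplete D = record
    { ι = _ ; isSeqColimit = isColimit⇒isSeqColimit D Id _ (Colimit.isColimit (cocomplete (ω s) _)) }

  -- ℕ is directed, so a cocone on the diagonal Γ(Xₙ , Yₙ) extends to all Γ(Xₙ , Yₘ).
  module Diagonal (Γ : Functor (C ×C C) C)
    (pres₁ : ∀ Y → PreservesSeqColimits (Γ ∘F (Id ※ const Y)))
    (pres₂ : ∀ X → PreservesSeqColimits (Γ ∘F (const X ※ Id)))
    {D E : Chain} {A B : Obj} {ι : ∀ n → Chain.X D n ⇒ A} {κ : ∀ n → Chain.X E n ⇒ B}
    (K : IsSeqColimit D ι) (M : IsSeqColimit E κ) where

    private
      module Γ = Functor Γ
      module D = Chain D
      module E = Chain E
      module K = IsSeqColimit K
      module M = IsSeqColimit M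
      module K₁ Y = IsSeqColimit (pres₁ Y K)
      module M₂ X = IsSeqColimit (pres₂ X M)

    diagonalChain : Chain
    diagonalChain = record
      { X = λ n → Γ.F₀ (D.X n , E.X n)
      ; x = λ n → Γ.F₁ (D.x n , E.x n)
      }

    module _ {L : Obj} (c : ∀ n → Γ.F₀ (D.X n , E.X n) ⇒ L)
             (q : ∀ n → c (suc n) ∘ Γ.F₁ (D.x n , E.x n) ≈ c n) where

      private
        -- The value at (n , m) as read off at a common upper bound k; `c₂-next` shows that raising
        -- k changes nothing.
        c₂ : ∀ {n m k} → Reach s n k → Reach s m k → Γ.F₀ (D.X n , E.X m) ⇒ L
        c₂ {k = k} p r = c k ∘ Γ.F₁ (D.to p , E.to r)

        c₂-next : ∀ {n m k} (p : Reach s n k) (r : Reach s m k) → c₂ (next p) (next r) ≈ c₂ p r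
        c₂-next p r = Equiv.trans (∘-resp-≈ʳ Γ.homomorphism) (pullˡ (q _))

        c₂-irrelevant : ∀ {n m k k′} → k ≡ k′ → (p : Reach s n k) (r : Reach s m k)
          (p′ : Reach s n k′) (r′ : Reach s m k′) → c₂ p r ≈ c₂ p′ r′
        c₂-irrelevant ≡.refl p r p′ r′ =
          ∘-resp-≈ʳ (Γ.F-resp-≈ (D.to-irrelevant p p′ , E.to-irrelevant r r′))

        step : ∀ {n} → Reach s n (suc n)
        step = next here

        c₂-∘ : ∀ {n n′ m m′ k} (a : Reach s n n′) (b : Reach s m m′)
          (p : Reach s n′ k) (r : Reach s m′ k) →
          c₂ p r ∘ Γ.F₁ (D.to a , E.to b) ≈ c₂ (a ⨾ p) (b ⨾ r)
        c₂-∘ a b p r = pullʳ (Equiv.trans (Equiv.sym Γ.homomorphism)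
          (Γ.F-resp-≈ (Equiv.sym (D.to-⨾ a p) , Equiv.sym (E.to-⨾ b r))))

        -- The bound m + n grows by one with either index, so compatibility in each variable is a
        -- single use of `c₂-next`. For the first index the bounds agree only up to `+-suc`, hence
        -- the equation between bounds in `c₂-irrelevant`.
        entry : ∀ n m → Γ.F₀ (D.X n , E.X m) ⇒ L
        entry n m = c₂ (Reach-+ʳ m n) (Reach-+ˡ m n)

        entry-commute₂ : ∀ n m → entry n (suc m) ∘ Γ.F₁ (id , E.x m) ≈ entry n m
        entry-commute₂ n m = begin
          entry n (suc m) ∘ Γ.F₁ (id , E.x m)
            ≈⟨ ∘-resp-≈ʳ (Γ.F-resp-≈ (Equiv.refl , Equiv.sym identityʳ)) ⟩
          entry n (suc m) ∘ Γ.F₁ (D.to here , E.to step)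
            ≈⟨ c₂-∘ here step (Reach-+ʳ (suc m) n) (Reach-+ˡ (suc m) n) ⟩
          c₂ (here ⨾ Reach-+ʳ (suc m) n) (step ⨾ Reach-+ˡ (suc m) n)
            ≈⟨ c₂-irrelevant ≡.refl (here ⨾ Reach-+ʳ (suc m) n) (step ⨾ Reach-+ˡ (suc m) n)
                             (next (Reach-+ʳ m n)) (next (Reach-+ˡ m n)) ⟩
          c₂ (next (Reach-+ʳ m n)) (next (Reach-+ˡ m n))
            ≈⟨ c₂-next (Reach-+ʳ m n) (Reach-+ˡ m n) ⟩
          entry n m ∎

        entry-commute₁ : ∀ n m → entry (suc n) m ∘ Γ.F₁ (D.x n , id) ≈ entry n m
        entry-commute₁ n m = begin
          entry (suc n) m ∘ Γ.F₁ (D.x n , id)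
            ≈⟨ ∘-resp-≈ʳ (Γ.F-resp-≈ (Equiv.sym identityʳ , Equiv.refl)) ⟩
          entry (suc n) m ∘ Γ.F₁ (D.to step , E.to here)
            ≈⟨ c₂-∘ step here (Reach-+ʳ m (suc n)) (Reach-+ˡ m (suc n)) ⟩
          c₂ (step ⨾ Reach-+ʳ m (suc n)) (here ⨾ Reach-+ˡ m (suc n))
            ≈⟨ c₂-irrelevant (+-suc m n) (step ⨾ Reach-+ʳ m (suc n)) (here ⨾ Reach-+ˡ m (suc n))
                             (next (Reach-+ʳ m n)) (next (Reach-+ˡ m n)) ⟩
          c₂ (next (Reach-+ʳ m n)) (next (Reach-+ˡ m n))
            ≈⟨ c₂-next (Reach-+ʳ m n) (Reach-+ˡ m n) ⟩
          entry n m ∎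

        row : ∀ n → Γ.F₀ (D.X n , B) ⇒ L
        row n = M₂.rep (D.X n) (entry n) (entry-commute₂ n)

        row-commute : ∀ n → row (suc n) ∘ Γ.F₁ (D.x n , id) ≈ row n
        row-commute n = M₂.rep-ext (D.X n) λ m → begin
          (row (suc n) ∘ Γ.F₁ (D.x n , id)) ∘ Γ.F₁ (id , κ m)
            ≈⟨ pullʳ (Γ.square (Equiv.trans identityʳ (Equiv.sym identityˡ)
                              , Equiv.trans identityˡ (Equiv.sym identityʳ))) ⟩
          row (suc n) ∘ (Γ.F₁ (id , κ m) ∘ Γ.F₁ (D.x n , id))
            ≈⟨ pullˡ (M₂.rep-commute (D.X (suc n)) _ _ m) ⟩
          entry (suc n) m ∘ Γ.F₁ (D.x n , id)
            ≈⟨ entry-commute₁ n m ⟩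
          entry n m
            ≈⟨ M₂.rep-commute (D.X n) _ _ m ⟨
          row n ∘ Γ.F₁ (id , κ m) ∎

      diagonalRep : Γ.F₀ (A , B) ⇒ L
      diagonalRep = K₁.rep B row row-commute

      diagonalRep-commute : ∀ n → diagonalRep ∘ Γ.F₁ (ι n , κ n) ≈ c n
      diagonalRep-commute n = begin
        diagonalRep ∘ Γ.F₁ (ι n , κ n)
          ≈⟨ ∘-resp-≈ʳ (Γ.F-resp-≈ (Equiv.sym identityʳ , Equiv.sym identityˡ)) ⟩
        diagonalRep ∘ Γ.F₁ (ι n ∘ id , id ∘ κ n)
          ≈⟨ ∘-resp-≈ʳ Γ.homomorphism ⟩
        diagonalRep ∘ (Γ.F₁ (ι n , id) ∘ Γ.F₁ (id , κ n))
          ≈⟨ pullˡ (K₁.rep-commute B row row-commute n) ⟩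
        row n ∘ Γ.F₁ (id , κ n)
          ≈⟨ M₂.rep-commute (D.X n) _ _ n ⟩
        entry n n
          ≈⟨ cofinal (Reach-+ʳ n n) (Reach-+ˡ n n) ⟩
        c n ∎
        where
          -- `entry n n` is read off at n + n; removing one `next` at a time descends to n. The
          -- second path is replaced by a copy of the first, so that both shrink together.
          cofinal : ∀ {k n} (p r : Reach s n k) → c₂ p r ≈ c n
          cofinal here     r = Equiv.trans (c₂-irrelevant ≡.refl here r here here)
            (Equiv.trans (∘-resp-≈ʳ Γ.identity) identityʳ)
          cofinal (next p) r = Equiv.trans (c₂-irrelevant ≡.refl (next p) r (next p) (next p))
            (Equiv.trans (c₂-next p p) (cofinal p p))

    -- Each leg at (n , m) factors through the diagonal leg at m + n, so the diagonal legs are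
    -- jointly epic as soon as all legs are.
    diagonal-ext : ∀ {L} {f g : Γ.F₀ (A , B) ⇒ L} →
      (∀ n → f ∘ Γ.F₁ (ι n , κ n) ≈ g ∘ Γ.F₁ (ι n , κ n)) → f ≈ g
    diagonal-ext {_} {f} {g} p = K₁.rep-ext B λ n → M₂.rep-ext (D.X n) λ m →
      Equiv.trans (split f n m) (Equiv.trans (∘-resp-≈ˡ (p (m ℕ.+ n))) (Equiv.sym (split g n m)))
      where
        split : ∀ {L} (f : Γ.F₀ (A , B) ⇒ L) n m → (f ∘ Γ.F₁ (ι n , id)) ∘ Γ.F₁ (id , κ m) ≈
          (f ∘ Γ.F₁ (ι (m ℕ.+ n) , κ (m ℕ.+ n))) ∘ Γ.F₁ (D.to (Reach-+ʳ m n) , E.to (Reach-+ˡ m n))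
        split f n m = Equiv.trans (pullʳ (Γ.square
            ( Equiv.trans identityʳ (Equiv.sym (to-commute D Id ι K.ι-commute (Reach-+ʳ m n)))
            , Equiv.trans identityˡ (Equiv.sym (to-commute E Id κ M.ι-commute (Reach-+ˡ m n))))))
          (Equiv.sym assoc)

    isSeqColimit : IsSeqColimit diagonalChain (λ n → Γ.F₁ (ι n , κ n))
    isSeqColimit = record
      { ι-commute   = λ n → Equiv.trans (Equiv.sym Γ.homomorphism)
                                        (Γ.F-resp-≈ (K.ι-commute n , M.ι-commute n))
      ; rep         = diagonalRep
      ; rep-commute = diagonalRep-commute
      ; rep-ext     = diagonal-ext
      }

-- Finite coproducts and their images under cocontinuous functors.

module Copairing {C : Category o s s} (cocomplete : Cocomplete C) where
  open Category C
  open Composites C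
  open FiniteCoproducts cocomplete

  []-resp-≈ : ∀ {A B X} {f f′ : A ⇒ X} {g g′ : B ⇒ X} → f ≈ f′ → g ≈ g′ → [ f , g ] ≈ [ f′ , g′ ]
  []-resp-≈ p q = []-unique (Equiv.trans inject₁ p) (Equiv.trans inject₂ q)

  ∘-[] : ∀ {A B X Y} {f : A ⇒ X} {g : B ⇒ X} {h : X ⇒ Y} → h ∘ [ f , g ] ≈ [ h ∘ f , h ∘ g ]
  ∘-[] = []-unique (pullʳ inject₁) (pullʳ inject₂)

  []-∘-+₁ : ∀ {A A′ B B′ X} {f : A ⇒ X} {g : B ⇒ X} {h : A′ ⇒ A} {k : B′ ⇒ B} →
            [ f , g ] ∘ (h +₁ k) ≈ [ f ∘ h , g ∘ k ]
  []-∘-+₁ = []-unique (Equiv.trans (pullʳ inject₁) (pullˡ inject₁))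
                      (Equiv.trans (pullʳ inject₂) (pullˡ inject₂))

  private
    Two : Category s s s
    Two = Discrete (Lift s Bool)

    -- Cocontinuity speaks of colimits of diagrams, so the universal properties of `A + B` and `∅`
    -- are recast here as colimits of discrete diagrams.
    summands : Obj → Obj → Functor Two C
    summands A B = discreteDiagram C λ { (lift true) → A ; (lift false) → B }

    +-cocone : ∀ A B → Cocone (summands A B)
    +-cocone A B = record
      { apex    = A + B
      ; ψ       = λ { (lift true) → i₁ ; (lift false) → i₂ }
      ; commute = λ { ≡.refl → identityʳ }
      }

    +-isColimit : ∀ A B → IsColimit (+-cocone A B)
    +-isColimit A B = record
      { rep         = λ L → [ Cocone.ψ L (lift true) , Cocone.ψ L (lift false) ]
      ; rep-commute = λ { L (lift true) → inject₁ ; L (lift false) → inject₂ }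
      ; rep-unique  = λ L h p → []-unique (p (lift true)) (p (lift false))
      }

    empty : Functor (Discrete ⊥) C
    empty = discreteDiagram C λ ()

    ∅-cocone : Cocone empty
    ∅-cocone = record { apex = ∅ ; ψ = λ () ; commute = λ { {()} } }

    ∅-isColimit : IsColimit ∅-cocone
    ∅-isColimit = record
      { rep         = λ L → ¡
      ; rep-commute = λ L ()
      ; rep-unique  = λ L h _ → ¡-unique h
      }

  module Preserved (Q : Endofunctor C) (cocont : Cocontinuous Q) where
    open Functor Q

    private
      module P A B = IsColimit (cocont Two (+-cocone A B) (+-isColimit A B))

      cocone : ∀ {A B X} → F₀ A ⇒ X → F₀ B ⇒ X → Cocone (Q ∘F summands A B)
      cocone {X = X} f g = record
        { apex    = X
        ; ψ       = λ { (lift true) → f ; (lift false) → g }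
        ; commute = λ { ≡.refl → Equiv.trans (∘-resp-≈ʳ identity) identityʳ }
        }

    copair : ∀ {A B X} → F₀ A ⇒ X → F₀ B ⇒ X → F₀ (A + B) ⇒ X
    copair f g = P.rep _ _ (cocone f g)

    copair₁ : ∀ {A B X} {f : F₀ A ⇒ X} {g : F₀ B ⇒ X} → copair f g ∘ F₁ i₁ ≈ f
    copair₁ {f = f} {g} = P.rep-commute _ _ (cocone f g) (lift true)

    copair₂ : ∀ {A B X} {f : F₀ A ⇒ X} {g : F₀ B ⇒ X} → copair f g ∘ F₁ i₂ ≈ g
    copair₂ {f = f} {g} = P.rep-commute _ _ (cocone f g) (lift false)

    copair-ext : ∀ {A B X} {f g : F₀ (A + B) ⇒ X} →
                 f ∘ F₁ i₁ ≈ g ∘ F₁ i₁ → f ∘ F₁ i₂ ≈ g ∘ F₁ i₂ → f ≈ g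
    copair-ext {f = f} {g} p q = Equiv.trans
      (P.rep-unique _ _ c f λ { (lift true) → p ; (lift false) → q })
      (Equiv.sym (P.rep-unique _ _ c g λ { (lift true) → Equiv.refl ; (lift false) → Equiv.refl }))
      where c = cocone (g ∘ F₁ i₁) (g ∘ F₁ i₂)

    initial : ∀ {X} → F₀ ∅ ⇒ X
    initial {X} = IsColimit.rep (cocont (Discrete ⊥) ∅-cocone ∅-isColimit)
      (record { apex = X ; ψ = λ () ; commute = λ { {()} } })

    initial-unique : ∀ {X} (f g : F₀ ∅ ⇒ X) → f ≈ g
    initial-unique f g = Equiv.trans (unique f λ ()) (Equiv.sym (unique g λ ()))
      where unique = IsColimit.rep-unique (cocont (Discrete ⊥) ∅-cocone ∅-isColimit)
                       (record { apex = _ ; ψ = λ () ; commute = λ { {()} } })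

-- Iteration out of Q A for a cocontinuous Q.

module Iteration {C : Category o s s} where
  open Category C
  open HomReasoning
  open Composites C

  IsHom : (F : Endofunctor C) → let open Functor F in ∀ {A B} → F₀ A ⇒ A → F₀ B ⇒ B → A ⇒ B → Set s
  IsHom F a b f = f ∘ a ≈ b ∘ Functor.F₁ F f

  IsHom-∘ : (F : Endofunctor C) → let open Functor F in
    ∀ {A B D} {a : F₀ A ⇒ A} {b : F₀ B ⇒ B} {c : F₀ D ⇒ D} {g : B ⇒ D} {f : A ⇒ B} → IsHom F b c g → IsHom F a b f → IsHom F a c (g ∘ f)
  IsHom-∘ F {a = a} {b} {c} {g} {f} q p = begin
    (g ∘ f) ∘ a                   ≈⟨ pullʳ p ⟩
    g ∘ (b ∘ F₁ f)                ≈⟨ extend q ⟩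
    c ∘ (F₁ g ∘ F₁ f)             ≈⟨ ∘-resp-≈ʳ homomorphism ⟨
    c ∘ F₁ (g ∘ f)                ∎
    where open Functor F

  IsHom-id : (F : Endofunctor C) → let open Functor F in ∀ {A} {a : F₀ A ⇒ A} → IsHom F a a id
  IsHom-id F = Equiv.trans identityˡ
    (Equiv.sym (Equiv.trans (∘-resp-≈ʳ (Functor.identity F)) identityʳ))

  -- Here f is the result of the recursion on Z, while k : Z ⇒ A keeps the unprocessed argument
  -- available, as in primitive recursion. Naturality in Z allows one step to be used at every stage
  -- of a chain and at A itself.
  record Step (F Q : Endofunctor C) (A B : Obj) : Set (o ⊔ s) where
    private
      module F = Functor F
      module Q = Functor Q
    field
      Φ         : ∀ {Z} → Z ⇒ A → Q.F₀ Z ⇒ B → Q.F₀ (F.F₀ Z) ⇒ B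
      Φ-resp-≈  : ∀ {Z} {k k′ : Z ⇒ A} {f f′ : Q.F₀ Z ⇒ B} → k ≈ k′ → f ≈ f′ → Φ k f ≈ Φ k′ f′
      Φ-natural : ∀ {Z Z′} (h : Z′ ⇒ Z) (k : Z ⇒ A) (f : Q.F₀ Z ⇒ B) →
                  Φ k f ∘ Q.F₁ (F.F₁ h) ≈ Φ (k ∘ h) (f ∘ Q.F₁ h)

  -- Iteration out of Q A, in the style of Mendler and of Bird and Paterson; Q = Id and
  -- Φ k f = b ∘ F f is the universal property of the free F-algebra A on X.
  record Iterative (F : Endofunctor C) {X A : Obj} (η : X ⇒ A) (σ : Functor.F₀ F A ⇒ A) :
                   Set (o ⊔ lsuc s) where
    private module F = Functor F
    field
      iter     : (Q : Endofunctor C) → Cocontinuous Q → let open Functor Q in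
                 ∀ {B} → Step F Q A B → F₀ X ⇒ B → F₀ A ⇒ B
      iter-η   : ∀ {Q : Endofunctor C} (cocont : Cocontinuous Q) → let open Functor Q in
                 ∀ {B} (Φ : Step F Q A B) (g : F₀ X ⇒ B) → iter Q cocont Φ g ∘ F₁ η ≈ g
      iter-σ   : ∀ {Q : Endofunctor C} (cocont : Cocontinuous Q) → let open Functor Q in
                 ∀ {B} (Φ : Step F Q A B) (g : F₀ X ⇒ B) →
                 iter Q cocont Φ g ∘ F₁ σ ≈ Step.Φ Φ id (iter Q cocont Φ g)
      iter-ext : ∀ {Q : Endofunctor C} (cocont : Cocontinuous Q) → let open Functor Q in
                 ∀ {B} (Φ : Step F Q A B) {f g : F₀ A ⇒ B} → f ∘ F₁ η ≈ g ∘ F₁ η →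
                 f ∘ F₁ σ ≈ Step.Φ Φ id f → g ∘ F₁ σ ≈ Step.Φ Φ id g → f ≈ g

    private
      Id-cocontinuous : Cocontinuous (Id {C = C})
      Id-cocontinuous J K isColimit = record
        { rep         = λ L → rep (fromId L)
        ; rep-commute = λ L → rep-commute (fromId L)
        ; rep-unique  = λ L → rep-unique (fromId L)
        }
        where
          open IsColimit isColimit
          fromId : ∀ {D : Functor J C} → Cocone (Id ∘F D) → Cocone D
          fromId L = record { apex = Cocone.apex L ; ψ = Cocone.ψ L ; commute = Cocone.commute L }

      algebraStep : ∀ {B} → F.F₀ B ⇒ B → Step F Id A B
      algebraStep b = record
        { Φ         = λ _ f → b ∘ F.F₁ f
        ; Φ-resp-≈  = λ _ p → ∘-resp-≈ʳ (F.F-resp-≈ p)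
        ; Φ-natural = λ h _ f → pullʳ (Equiv.sym F.homomorphism)
        }

    fold : ∀ {B} → X ⇒ B → F.F₀ B ⇒ B → A ⇒ B
    fold g b = iter Id Id-cocontinuous (algebraStep b) g

    fold-η : ∀ {B} {g : X ⇒ B} {b : F.F₀ B ⇒ B} → fold g b ∘ η ≈ g
    fold-η {g = g} {b} = iter-η Id-cocontinuous (algebraStep b) g

    fold-σ : ∀ {B} {g : X ⇒ B} {b : F.F₀ B ⇒ B} → IsHom F σ b (fold g b)
    fold-σ {g = g} {b} = iter-σ Id-cocontinuous (algebraStep b) g

    fold-ext : ∀ {B} {b : F.F₀ B ⇒ B} {f g : A ⇒ B} →
               f ∘ η ≈ g ∘ η → IsHom F σ b f → IsHom F σ b g → f ≈ g
    fold-ext {b = b} = iter-ext Id-cocontinuous (algebraStep b)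

-- Free algebras as colimits of chains.

module FreeAlgebra {C : Category o s s} (cocomplete : Cocomplete C)
  (F : Endofunctor C) (pres : SequentialColimits.PreservesSeqColimits C F) (X : Category.Obj C) where

  open Category C
  open HomReasoning
  open Composites C
  open FiniteCoproducts cocomplete
  open Copairing cocomplete
  open SequentialColimits C
  open Iteration {C = C}
  private module F = Functor F

  private
    K : ℕ → Obj
    K zero    = X
    K (suc n) = X + F.F₀ (K n)

    k : ∀ n → K n ⇒ K (suc n)
    k zero    = i₁
    k (suc n) = [ i₁ , i₂ ∘ F.F₁ (k n) ]

    chain : Chain
    chain = record { X = K ; x = k }

    open SeqColimit (seqColimit cocomplete chain)
    module F-colimit = IsSeqColimit (pres isSeqColimit)

    ι-i₁ : ∀ n → ι (suc n) ∘ i₁ ≈ ι zero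
    ι-i₁ zero    = ι-commute zero
    ι-i₁ (suc n) = begin
      ι (suc (suc n)) ∘ i₁                ≈⟨ ∘-resp-≈ʳ inject₁ ⟨
      ι (suc (suc n)) ∘ (k (suc n) ∘ i₁)  ≈⟨ pullˡ (ι-commute (suc n)) ⟩
      ι (suc n) ∘ i₁                      ≈⟨ ι-i₁ n ⟩
      ι zero                              ∎

    ι-i₂ : ∀ n → (ι (suc (suc n)) ∘ i₂) ∘ F.F₁ (k n) ≈ ι (suc n) ∘ i₂
    ι-i₂ n = begin
      (ι (suc (suc n)) ∘ i₂) ∘ F.F₁ (k n) ≈⟨ pullʳ (Equiv.sym inject₂) ⟩
      ι (suc (suc n)) ∘ (k (suc n) ∘ i₂)  ≈⟨ pullˡ (ι-commute (suc n)) ⟩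
      ι (suc n) ∘ i₂                      ∎

  carrier : Obj
  carrier = apex

  η : X ⇒ carrier
  η = ι zero

  -- F applied to the colimit is again a colimit, of the F (K n), and F (K n) is the second summand
  -- of the next stage; this shift of index is the algebra structure.
  σ : F.F₀ carrier ⇒ carrier
  σ = F-colimit.rep (λ n → ι (suc n) ∘ i₂) ι-i₂

  private
    σ-ι : ∀ n → σ ∘ F.F₁ (ι n) ≈ ι (suc n) ∘ i₂
    σ-ι = F-colimit.rep-commute _ ι-i₂

    module _ {Q : Endofunctor C} (cocont : Cocontinuous Q) where
      open Functor Q
      open Preserved Q cocont

      Q-pres : PreservesSeqColimits Q
      Q-pres = finitary⇒preservesSeq {F = Q} (λ J _ → cocont J)

      module Q-colimit = IsSeqColimit (Q-pres isSeqColimit)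
      module QF-colimit = IsSeqColimit (Q-pres (pres isSeqColimit))

      module _ {B} (Φ : Step F Q carrier B) (g : F₀ X ⇒ B) where
        open Step Φ renaming (Φ to φ)

        -- The iterate restricted to stage n. Since Q preserves coproducts, a map out of Q (X + F (K
        -- n)) is given by `g` and by one step whose tracking map is the leg `ι n`.
        approx : ∀ n → F₀ (K n) ⇒ B
        approx zero    = g
        approx (suc n) = copair g (φ (ι n) (approx n))

        approx-commute : ∀ n → approx (suc n) ∘ F₁ (k n) ≈ approx n
        approx-commute zero    = copair₁
        approx-commute (suc n) = copair-ext
          (begin
            (approx (suc (suc n)) ∘ F₁ (k (suc n))) ∘ F₁ i₁
              ≈⟨ pullʳ (Equiv.trans (Equiv.sym homomorphism) (F-resp-≈ inject₁)) ⟩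
            approx (suc (suc n)) ∘ F₁ i₁
              ≈⟨ copair₁ ⟩
            g
              ≈⟨ copair₁ ⟨
            approx (suc n) ∘ F₁ i₁ ∎)
          (begin
            (approx (suc (suc n)) ∘ F₁ (k (suc n))) ∘ F₁ i₂
              ≈⟨ pullʳ (square inject₂) ⟩
            approx (suc (suc n)) ∘ (F₁ i₂ ∘ F₁ (F.F₁ (k n)))
              ≈⟨ pullˡ copair₂ ⟩
            φ (ι (suc n)) (approx (suc n)) ∘ F₁ (F.F₁ (k n))
              ≈⟨ Φ-natural (k n) (ι (suc n)) (approx (suc n)) ⟩
            φ (ι (suc n) ∘ k n) (approx (suc n) ∘ F₁ (k n))
              ≈⟨ Φ-resp-≈ (ι-commute n) (approx-commute n) ⟩
            φ (ι n) (approx n)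
              ≈⟨ copair₂ ⟨
            approx (suc n) ∘ F₁ i₂ ∎)

        limit : F₀ carrier ⇒ B
        limit = Q-colimit.rep approx approx-commute

        limit-ι : ∀ n → limit ∘ F₁ (ι n) ≈ approx n
        limit-ι = Q-colimit.rep-commute approx approx-commute

        φ-ι : ∀ f n → φ id f ∘ F₁ (F.F₁ (ι n)) ≈ φ (ι n) (f ∘ F₁ (ι n))
        φ-ι f n = Equiv.trans (Φ-natural (ι n) id f) (Φ-resp-≈ identityˡ Equiv.refl)

        -- F and then Q preserve the colimit, so it is enough to compare on each Q (F (K n)), where
        -- the equation is the recursive clause of `approx`.
        limit-σ : limit ∘ F₁ σ ≈ φ id limit
        limit-σ = QF-colimit.rep-ext λ n → begin
          (limit ∘ F₁ σ) ∘ F₁ (F.F₁ (ι n))     ≈⟨ pullʳ (square (σ-ι n)) ⟩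
          limit ∘ (F₁ (ι (suc n)) ∘ F₁ i₂)     ≈⟨ pullˡ (limit-ι (suc n)) ⟩
          approx (suc n) ∘ F₁ i₂               ≈⟨ copair₂ ⟩
          φ (ι n) (approx n)                   ≈⟨ Φ-resp-≈ Equiv.refl (limit-ι n) ⟨
          φ (ι n) (limit ∘ F₁ (ι n))           ≈⟨ φ-ι limit n ⟨
          φ id limit ∘ F₁ (F.F₁ (ι n))         ∎

        -- By induction on n, the two equations for f determine it on every stage K n.
        limit-unique : (f : F₀ carrier ⇒ B) → f ∘ F₁ η ≈ g → f ∘ F₁ σ ≈ φ id f → f ≈ limit
        limit-unique f p q = Q-colimit.rep-ext λ n → Equiv.trans (agree n) (Equiv.sym (limit-ι n))
          where
            agree : ∀ n → f ∘ F₁ (ι n) ≈ approx n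
            agree zero    = p
            agree (suc n) = copair-ext
              (begin
                (f ∘ F₁ (ι (suc n))) ∘ F₁ i₁
                  ≈⟨ pullʳ (Equiv.trans (Equiv.sym homomorphism) (F-resp-≈ (ι-i₁ n))) ⟩
                f ∘ F₁ η
                  ≈⟨ p ⟩
                g
                  ≈⟨ copair₁ ⟨
                approx (suc n) ∘ F₁ i₁ ∎)
              (begin
                (f ∘ F₁ (ι (suc n))) ∘ F₁ i₂
                  ≈⟨ pullʳ (square (Equiv.sym (σ-ι n))) ⟩
                f ∘ (F₁ σ ∘ F₁ (F.F₁ (ι n)))
                  ≈⟨ pullˡ q ⟩
                φ id f ∘ F₁ (F.F₁ (ι n))
                  ≈⟨ φ-ι f n ⟩
                φ (ι n) (f ∘ F₁ (ι n))
                  ≈⟨ Φ-resp-≈ Equiv.refl (agree n) ⟩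
                φ (ι n) (approx n)
                  ≈⟨ copair₂ ⟨
                approx (suc n) ∘ F₁ i₂ ∎)

  iterative : Iterative F η σ
  iterative = record
    { iter     = λ Q cocont → limit {Q} cocont
    ; iter-η   = λ {Q} cocont Φ g → limit-ι {Q} cocont Φ g zero
    ; iter-σ   = λ {Q} cocont → limit-σ {Q} cocont
    ; iter-ext = λ {Q} cocont Φ {f} {g} p q r → Equiv.trans
        (limit-unique {Q} cocont Φ _ f p q)
        (Equiv.sym (limit-unique {Q} cocont Φ _ g Equiv.refl r))
    }

-- Free monads are algebraically free.

module FreeStructure {o s} {C : Category o s s} (F : Endofunctor C) (M : Monad C)
  (inclusion : NaturalTransformation F (Monad.functor M)) where
  open Category C
  open HomReasoning
  open Composites C
  open Iteration {C = C}
  private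
    module F = Functor F
    module M = Monad M
    module θ = NaturalTransformation inclusion

  -- The F-algebra underlying the free M-algebra on X.
  α : ∀ X → F.F₀ (M.F₀ X) ⇒ M.F₀ X
  α X = M.μ X ∘ θ.η (M.F₀ X)

  F₁-isHom : ∀ {X Y} (f : X ⇒ Y) → IsHom F (α X) (α Y) (M.F₁ f)
  F₁-isHom {X} {Y} f = begin
    M.F₁ f ∘ (M.μ X ∘ θ.η _)                 ≈⟨ extend (M.mult.commute f) ⟨
    M.μ Y ∘ (M.F₁ (M.F₁ f) ∘ θ.η _)          ≈⟨ ∘-resp-≈ʳ (θ.commute (M.F₁ f)) ⟨
    M.μ Y ∘ (θ.η _ ∘ F.F₁ (M.F₁ f))          ≈⟨ assoc ⟨
    α Y ∘ F.F₁ (M.F₁ f)                      ∎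

  μ-isHom : ∀ X → IsHom F (α (M.F₀ X)) (α X) (M.μ X)
  μ-isHom X = begin
    M.μ X ∘ (M.μ (M.F₀ X) ∘ θ.η _)           ≈⟨ extend M.μ-assoc ⟨
    M.μ X ∘ (M.F₁ (M.μ X) ∘ θ.η _)           ≈⟨ ∘-resp-≈ʳ (θ.commute (M.μ X)) ⟨
    M.μ X ∘ (θ.η _ ∘ F.F₁ (M.μ X))           ≈⟨ assoc ⟨
    α X ∘ F.F₁ (M.μ X)                       ∎

  α-η : ∀ X → α X ∘ F.F₁ (M.η X) ≈ θ.η X
  α-η X = begin
    α X ∘ F.F₁ (M.η X)                       ≈⟨ pullʳ (θ.commute (M.η X)) ⟩
    M.μ X ∘ (M.F₁ (M.η X) ∘ θ.η X)           ≈⟨ cancel M.μ-identityˡ ⟩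
    θ.η X                                    ∎

  -- This asks for iteration out of Q (M X) for every cocontinuous Q; the case Q = `Id` says that M
  -- X is the free F-algebra on X.
  AlgebraicallyFree : Set (o ⊔ lsuc s)
  AlgebraicallyFree = ∀ X → Iterative F (M.η X) (α X)

module AlgebraicFreeness {C : Category o s s} (F : Endofunctor C)
  {K : Category.Obj C → Category.Obj C} {η : ∀ X → Category._⇒_ C X (K X)}
  {σ : ∀ X → Category._⇒_ C (Functor.F₀ F (K X)) (K X)}
  (iterative : ∀ X → Iteration.Iterative F (η X) (σ X)) where

  open Category C
  open Iteration {C = C}
  open HomReasoning
  open Composites C
  private
    module F = Functor F
    module Fold X = Iterative (iterative X)

    K₁ : ∀ {X Y} → X ⇒ Y → K X ⇒ K Y
    K₁ {X} {Y} f = Fold.fold X (η Y ∘ f) (σ Y)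

    μ : ∀ X → K (K X) ⇒ K X
    μ X = Fold.fold (K X) id (σ X)

    K₁-η : ∀ {X Y} (f : X ⇒ Y) → K₁ f ∘ η X ≈ η Y ∘ f
    K₁-η f = Fold.fold-η _

    K₁-isHom : ∀ {X Y} (f : X ⇒ Y) → IsHom F (σ X) (σ Y) (K₁ f)
    K₁-isHom f = Fold.fold-σ _

    μ-η : ∀ X → μ X ∘ η (K X) ≈ id
    μ-η X = Fold.fold-η _

    μ-isHom : ∀ X → IsHom F (σ (K X)) (σ X) (μ X)
    μ-isHom X = Fold.fold-σ _

    K-functor : Endofunctor C
    K-functor = record
      { F₀ = K
      ; F₁ = K₁
      ; identity = λ {X} → Fold.fold-ext X
          (Equiv.trans (K₁-η id) (Equiv.trans identityʳ (Equiv.sym identityˡ)))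
          (K₁-isHom id) (IsHom-id F)
      ; homomorphism = λ {X} {Y} {Z} {f} {g} → Fold.fold-ext X
          (begin
            K₁ (g ∘ f) ∘ η X      ≈⟨ K₁-η (g ∘ f) ⟩
            η Z ∘ (g ∘ f)         ≈⟨ extend (K₁-η g) ⟨
            K₁ g ∘ (η Y ∘ f)      ≈⟨ pullʳ (K₁-η f) ⟨
            (K₁ g ∘ K₁ f) ∘ η X   ∎)
          (K₁-isHom (g ∘ f)) (IsHom-∘ F (K₁-isHom g) (K₁-isHom f))
      ; F-resp-≈ = λ {X} {Y} {f} {g} p → Fold.fold-ext X
          (Equiv.trans (K₁-η f) (Equiv.trans (∘-resp-≈ʳ p) (Equiv.sym (K₁-η g))))
          (K₁-isHom f) (K₁-isHom g)
      }

    K-monad : Monad C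
    K-monad = record
      { functor = K-functor
      ; unit    = record { η = η ; commute = λ f → Equiv.sym (K₁-η f) }
      ; mult    = record
        { η       = μ
        ; commute = λ {X} {Y} f → Fold.fold-ext (K X)
            (begin
              (μ Y ∘ K₁ (K₁ f)) ∘ η (K X)   ≈⟨ pullʳ (K₁-η (K₁ f)) ⟩
              μ Y ∘ (η (K Y) ∘ K₁ f)        ≈⟨ cancel (μ-η Y) ⟩
              K₁ f                          ≈⟨ identityʳ ⟨
              K₁ f ∘ id                     ≈⟨ pullʳ (μ-η X) ⟨
              (K₁ f ∘ μ X) ∘ η (K X)        ∎)
            (IsHom-∘ F (μ-isHom Y) (K₁-isHom (K₁ f)))
            (IsHom-∘ F (K₁-isHom f) (μ-isHom X))
        }
      ; μ-assoc = λ {X} → Fold.fold-ext (K (K X))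
          (begin
            (μ X ∘ K₁ (μ X)) ∘ η (K (K X))  ≈⟨ pullʳ (K₁-η (μ X)) ⟩
            μ X ∘ (η (K X) ∘ μ X)           ≈⟨ cancel (μ-η X) ⟩
            μ X                             ≈⟨ identityʳ ⟨
            μ X ∘ id                        ≈⟨ pullʳ (μ-η (K X)) ⟨
            (μ X ∘ μ (K X)) ∘ η (K (K X))   ∎)
          (IsHom-∘ F (μ-isHom X) (K₁-isHom (μ X)))
          (IsHom-∘ F (μ-isHom X) (μ-isHom (K X)))
      ; μ-identityˡ = λ {X} → Fold.fold-ext X
          (begin
            (μ X ∘ K₁ (η X)) ∘ η X          ≈⟨ pullʳ (K₁-η (η X)) ⟩
            μ X ∘ (η (K X) ∘ η X)           ≈⟨ pullˡ (μ-η X) ⟩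
            id ∘ η X                        ∎)
          (IsHom-∘ F (μ-isHom X) (K₁-isHom (η X))) (IsHom-id F)
      ; μ-identityʳ = λ {X} → μ-η X
      }

    K-inclusion : NaturalTransformation F K-functor
    K-inclusion = record
      { η       = λ X → σ X ∘ F.F₁ (η X)
      ; commute = λ {X} {Y} f → begin
          (σ Y ∘ F.F₁ (η Y)) ∘ F.F₁ f       ≈⟨ pullʳ (F.square (Equiv.sym (K₁-η f))) ⟩
          σ Y ∘ (F.F₁ (K₁ f) ∘ F.F₁ (η X))  ≈⟨ extend (K₁-isHom f) ⟨
          K₁ f ∘ (σ X ∘ F.F₁ (η X))         ∎
      }

  module _ (M : FreeMonad F) where
    private
      module M = FreeMonad M
    open FreeStructure F M.monad M.inclusion renaming (μ-isHom to M-μ-isHom)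

    private
      module ext = MonadMorphism (M.extension K-monad K-inclusion)

      φ : ∀ X → M.F₀ X ⇒ K X
      φ = ext.α

      ψ : ∀ X → K X ⇒ M.F₀ X
      ψ X = Fold.fold X (M.η X) (α X)

      ψ-η : ∀ X → ψ X ∘ η X ≈ M.η X
      ψ-η X = Fold.fold-η X

      ψ-isHom : ∀ X → IsHom F (σ X) (α X) (ψ X)
      ψ-isHom X = Fold.fold-σ X

      φ-inclusion : ∀ X → φ X ∘ M.ηF X ≈ σ X ∘ F.F₁ (η X)
      φ-inclusion = M.extension-commute K-monad K-inclusion

      -- φ comes from the universal property among monads, so its compatibility with the algebra
      -- structures has to be extracted from multiplicativity and from its values on the inclusion
      -- of F.
      φ-isHom : ∀ X → IsHom F (α X) (σ X) (φ X)
      φ-isHom X = begin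
        φ X ∘ (M.μ X ∘ M.ηF _)
          ≈⟨ extend ext.mult-commute ⟩
        μ X ∘ ((K₁ (φ X) ∘ φ (M.F₀ X)) ∘ M.ηF _)
          ≈⟨ ∘-resp-≈ʳ (pullʳ (φ-inclusion (M.F₀ X))) ⟩
        μ X ∘ (K₁ (φ X) ∘ (σ _ ∘ F.F₁ (η _)))
          ≈⟨ ∘-resp-≈ʳ (NaturalTransformation.commute K-inclusion (φ X)) ⟨
        μ X ∘ ((σ _ ∘ F.F₁ (η _)) ∘ F.F₁ (φ X))
          ≈⟨ ∘-resp-≈ʳ assoc ⟩
        μ X ∘ (σ _ ∘ (F.F₁ (η _) ∘ F.F₁ (φ X)))
          ≈⟨ extend (μ-isHom X) ⟩
        σ X ∘ (F.F₁ (μ X) ∘ (F.F₁ (η _) ∘ F.F₁ (φ X)))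
          ≈⟨ ∘-resp-≈ʳ (cancel (Equiv.trans (Equiv.sym F.homomorphism)
               (Equiv.trans (F.F-resp-≈ (μ-η X)) F.identity))) ⟩
        σ X ∘ F.F₁ (φ X) ∎

      ψ-natural : ∀ {X Y} (f : X ⇒ Y) → ψ Y ∘ K₁ f ≈ M.F₁ f ∘ ψ X
      ψ-natural {X} {Y} f = Fold.fold-ext X
        (begin
          (ψ Y ∘ K₁ f) ∘ η X      ≈⟨ pullʳ (K₁-η f) ⟩
          ψ Y ∘ (η Y ∘ f)         ≈⟨ pullˡ (ψ-η Y) ⟩
          M.η Y ∘ f               ≈⟨ M.unit.commute f ⟩
          M.F₁ f ∘ M.η X          ≈⟨ pullʳ (ψ-η X) ⟨
          (M.F₁ f ∘ ψ X) ∘ η X    ∎)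
        (IsHom-∘ F (ψ-isHom Y) (K₁-isHom f)) (IsHom-∘ F (F₁-isHom f) (ψ-isHom X))

      ψ-μ : ∀ X → ψ X ∘ μ X ≈ M.μ X ∘ (M.F₁ (ψ X) ∘ ψ (K X))
      ψ-μ X = Fold.fold-ext (K X)
        (begin
          (ψ X ∘ μ X) ∘ η (K X)                       ≈⟨ pullʳ (μ-η X) ⟩
          ψ X ∘ id                                    ≈⟨ identityʳ ⟩
          ψ X                                         ≈⟨ cancel M.μ-identityʳ ⟨
          M.μ X ∘ (M.η _ ∘ ψ X)                       ≈⟨ ∘-resp-≈ʳ (M.unit.commute (ψ X)) ⟩
          M.μ X ∘ (M.F₁ (ψ X) ∘ M.η (K X))            ≈⟨ ∘-resp-≈ʳ (pullʳ (ψ-η (K X))) ⟨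
          M.μ X ∘ ((M.F₁ (ψ X) ∘ ψ (K X)) ∘ η (K X))  ≈⟨ assoc ⟨
          (M.μ X ∘ (M.F₁ (ψ X) ∘ ψ (K X))) ∘ η (K X)  ∎)
        (IsHom-∘ F (ψ-isHom X) (μ-isHom X))
        (IsHom-∘ F (M-μ-isHom X) (IsHom-∘ F (F₁-isHom (ψ X)) (ψ-isHom (K X))))

      -- Naturality and multiplicativity of ψ make this an endomorphism of the monad M. It fixes the
      -- inclusion of F, so uniqueness of extensions identifies it with the identity.
      ψφ : MonadMorphism M.monad M.monad
      ψφ = record
        { nat = record
          { η       = λ X → ψ X ∘ φ X
          ; commute = λ {X} {Y} f → Equiv.trans (pullʳ (ext.commute f))
              (extend (ψ-natural f))
          }
        ; unit-commute = λ {X} → Equiv.trans (pullʳ ext.unit-commute) (ψ-η X)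
        ; mult-commute = λ {X} → begin
            (ψ X ∘ φ X) ∘ M.μ X
              ≈⟨ pullʳ ext.mult-commute ⟩
            ψ X ∘ (μ X ∘ (K₁ (φ X) ∘ φ (M.F₀ X)))
              ≈⟨ extend (ψ-μ X) ⟩
            M.μ X ∘ ((M.F₁ (ψ X) ∘ ψ (K X)) ∘ (K₁ (φ X) ∘ φ (M.F₀ X)))
              ≈⟨ ∘-resp-≈ʳ (pullʳ (extend (ψ-natural (φ X)))) ⟩
            M.μ X ∘ (M.F₁ (ψ X) ∘ (M.F₁ (φ X) ∘ (ψ (M.F₀ X) ∘ φ (M.F₀ X))))
              ≈⟨ ∘-resp-≈ʳ (pullˡ (Equiv.sym M.homomorphism)) ⟩
            M.μ X ∘ (M.F₁ (ψ X ∘ φ X) ∘ (ψ (M.F₀ X) ∘ φ (M.F₀ X))) ∎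
        }

      idM : MonadMorphism M.monad M.monad
      idM = record
        { nat = record
          { η       = λ X → id
          ; commute = λ f → Equiv.trans identityˡ (Equiv.sym identityʳ)
          }
        ; unit-commute = identityˡ
        ; mult-commute = Equiv.trans identityˡ
            (Equiv.sym (Equiv.trans (∘-resp-≈ʳ (Equiv.trans identityʳ M.identity)) identityʳ))
        }

      ψφ≈id : ∀ X → ψ X ∘ φ X ≈ id
      ψφ≈id X = Equiv.trans
        (M.extension-unique M.monad M.inclusion ψφ ψφ-inclusion X)
        (Equiv.sym (M.extension-unique M.monad M.inclusion idM (λ _ → identityˡ) X))
        where
          ψφ-inclusion : ∀ X → (ψ X ∘ φ X) ∘ M.ηF X ≈ M.ηF X
          ψφ-inclusion X = begin
            (ψ X ∘ φ X) ∘ M.ηF X            ≈⟨ pullʳ (φ-inclusion X) ⟩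
            ψ X ∘ (σ X ∘ F.F₁ (η X))        ≈⟨ extend (ψ-isHom X) ⟩
            α X ∘ (F.F₁ (ψ X) ∘ F.F₁ (η X)) ≈⟨ ∘-resp-≈ʳ (Equiv.trans (Equiv.sym F.homomorphism)
                                                              (F.F-resp-≈ (ψ-η X))) ⟩
            α X ∘ F.F₁ (M.η X)              ≈⟨ α-η X ⟩
            M.ηF X                          ∎

    -- By ψ ∘ φ ≈ id, M X is a retract of K X through algebra homomorphisms. A step over M X becomes
    -- one over K X when its tracking map is composed with ψ; iterates return along φ, and equality
    -- of iterates is tested after ψ.
    freeMonad-algebraicallyFree : AlgebraicallyFree
    freeMonad-algebraicallyFree X = record
      { iter = λ Q cocont Φ g → Fold.iter X Q cocont (transport Q Φ) g ∘ Functor.F₁ Q (φ X)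
      ; iter-η = λ {Q} cocont Φ g → Equiv.trans
          (pullʳ (Equiv.trans (Equiv.sym (Functor.homomorphism Q)) (Functor.F-resp-≈ Q ext.unit-commute)))
          (Fold.iter-η X {Q} cocont (transport Q Φ) g)
      ; iter-σ = λ {Q} cocont Φ g →
          let open Functor Q
              open Step Φ renaming (Φ to step)
              f = Fold.iter X Q cocont (transport Q Φ) g
          in begin
          (f ∘ F₁ (φ X)) ∘ F₁ (α X)
            ≈⟨ pullʳ (square (φ-isHom X)) ⟩
          f ∘ (F₁ (σ X) ∘ F₁ (F.F₁ (φ X)))
            ≈⟨ pullˡ (Fold.iter-σ X {Q} cocont (transport Q Φ) g) ⟩
          step (ψ X ∘ id) f ∘ F₁ (F.F₁ (φ X))
            ≈⟨ Φ-natural (φ X) (ψ X ∘ id) f ⟩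
          step ((ψ X ∘ id) ∘ φ X) (f ∘ F₁ (φ X))
            ≈⟨ Φ-resp-≈ (Equiv.trans (∘-resp-≈ˡ identityʳ) (ψφ≈id X)) Equiv.refl ⟩
          step id (f ∘ F₁ (φ X)) ∎
      ; iter-ext = λ {Q} cocont Φ {f} {g} p q r → begin
          f
            ≈⟨ unψ Q f ⟨
          (f ∘ Functor.F₁ Q (ψ X)) ∘ Functor.F₁ Q (φ X)
            ≈⟨ ∘-resp-≈ˡ (Fold.iter-ext X {Q} cocont (transport Q Φ)
                 (Equiv.trans (ψη Q f) (Equiv.trans p (Equiv.sym (ψη Q g))))
                 (isIterate Q Φ f q) (isIterate Q Φ g r)) ⟩
          (g ∘ Functor.F₁ Q (ψ X)) ∘ Functor.F₁ Q (φ X)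
            ≈⟨ unψ Q g ⟩
          g ∎
      }
      where
        transport : ∀ Q {B} → Step F Q (M.F₀ X) B → Step F Q (K X) B
        transport Q Φ = record
          { Φ         = λ k → step (ψ X ∘ k)
          ; Φ-resp-≈  = λ p → Φ-resp-≈ (∘-resp-≈ʳ p)
          ; Φ-natural = λ h k f → Equiv.trans (Φ-natural h (ψ X ∘ k) f) (Φ-resp-≈ assoc Equiv.refl)
          }
          where open Step Φ renaming (Φ to step)

        module _ (Q : Endofunctor C) where
          open Functor Q

          unψ : ∀ {B} (f : F₀ (M.F₀ X) ⇒ B) → (f ∘ F₁ (ψ X)) ∘ F₁ (φ X) ≈ f
          unψ f = Equiv.trans (pullʳ (Equiv.trans (Equiv.sym homomorphism)
            (Equiv.trans (F-resp-≈ (ψφ≈id X)) identity))) identityʳ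

          ψη : ∀ {B} (f : F₀ (M.F₀ X) ⇒ B) → (f ∘ F₁ (ψ X)) ∘ F₁ (η X) ≈ f ∘ F₁ (M.η X)
          ψη f = pullʳ (Equiv.trans (Equiv.sym homomorphism) (F-resp-≈ (ψ-η X)))

          isIterate : ∀ {B} (Φ : Step F Q (M.F₀ X) B) (f : F₀ (M.F₀ X) ⇒ B) →
                      f ∘ F₁ (α X) ≈ Step.Φ Φ id f →
                      (f ∘ F₁ (ψ X)) ∘ F₁ (σ X) ≈ Step.Φ Φ (ψ X ∘ id) (f ∘ F₁ (ψ X))
          isIterate Φ f p = begin
            (f ∘ F₁ (ψ X)) ∘ F₁ (σ X)          ≈⟨ pullʳ (square (ψ-isHom X)) ⟩
            f ∘ (F₁ (α X) ∘ F₁ (F.F₁ (ψ X)))   ≈⟨ pullˡ p ⟩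
            step id f ∘ F₁ (F.F₁ (ψ X))        ≈⟨ Φ-natural (ψ X) id f ⟩
            step (id ∘ ψ X) (f ∘ F₁ (ψ X))     ≈⟨ Φ-resp-≈ (Equiv.trans identityˡ (Equiv.sym identityʳ)) Equiv.refl ⟩
            step (ψ X ∘ id) (f ∘ F₁ (ψ X))     ∎
            where open Step Φ renaming (Φ to step)

-- Algebraically free monads inherit preservation of ω-colimits.

module MonadPreservesSeq {C : Category o s s} (cocomplete : Cocomplete C)
  (F : Endofunctor C) (pres : SequentialColimits.PreservesSeqColimits C F)
  (M : Monad C) (inclusion : NaturalTransformation F (Monad.functor M))
  (iterative : FreeStructure.AlgebraicallyFree F M inclusion) where

  open Category C
  open HomReasoning
  open Composites C
  open SequentialColimits C
  open Iteration {C = C}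
  open FreeStructure F M inclusion
  private
    module F = Functor F
    module M = Monad M
    module MF X = Iterative (iterative X)

  -- The colimit of M Yₙ is an F-algebra under A = colim Yₙ, hence receives a map from M A.
  preservesSeq : PreservesSeqColimits M.functor
  preservesSeq {D} {A} {κ} isColimit = record
    { ι-commute   = λ n → Equiv.trans (Equiv.sym M.homomorphism) (M.F-resp-≈ (κ-commute n))
    -- The universal property of W passes to M A because `toW` carries the legs `M.F₁ (κ n)` to the
    -- legs of W and `fromW` is a retraction of `toW`.
    ; rep         = λ c p → rep c p ∘ toW
    ; rep-commute = λ c p n → Equiv.trans (pullʳ (toW-κ n)) (rep-commute c p n)
    ; rep-ext     = λ {_} {f} {g} p → begin
        f                   ≈⟨ identityʳ ⟨
        f ∘ id              ≈⟨ ∘-resp-≈ʳ fromW-toW ⟨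
        f ∘ (fromW ∘ toW)   ≈⟨ extend (rep-ext λ n → Equiv.trans (pullʳ (fromW-w n))
                                 (Equiv.trans (p n) (Equiv.sym (pullʳ (fromW-w n))))) ⟩
        g ∘ (fromW ∘ toW)   ≈⟨ ∘-resp-≈ʳ fromW-toW ⟩
        g ∘ id              ≈⟨ identityʳ ⟩
        g                   ∎
    }
    where
      open Chain D renaming (X to Y; x to y)
      open IsSeqColimit isColimit using () renaming
        (ι-commute to κ-commute; rep to κ-rep; rep-commute to κ-rep-commute; rep-ext to κ-rep-ext)

      open SeqColimit (seqColimit cocomplete (mapChain M.functor D))
        renaming (apex to W; ι to w; ι-commute to w-commute)
      module FW = IsSeqColimit (pres isSeqColimit)

      algebra-link : ∀ n → (w (suc n) ∘ α (Y (suc n))) ∘ F.F₁ (M.F₁ (y n)) ≈ w n ∘ α (Y n)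
      algebra-link n = begin
        (w (suc n) ∘ α _) ∘ F.F₁ (M.F₁ (y n))  ≈⟨ pullʳ (Equiv.sym (F₁-isHom (y n))) ⟩
        w (suc n) ∘ (M.F₁ (y n) ∘ α (Y n))     ≈⟨ pullˡ (w-commute n) ⟩
        w n ∘ α (Y n)                          ∎

      algebra : F.F₀ W ⇒ W
      algebra = FW.rep (λ n → w n ∘ α (Y n)) algebra-link

      w-isHom : ∀ n → IsHom F (α (Y n)) algebra (w n)
      w-isHom n = Equiv.sym (FW.rep-commute _ algebra-link n)

      base-link : ∀ n → (w (suc n) ∘ M.η _) ∘ y n ≈ w n ∘ M.η _
      base-link n = Equiv.trans (pullʳ (M.unit.commute (y n))) (pullˡ (w-commute n))

      base : A ⇒ W
      base = κ-rep (λ n → w n ∘ M.η (Y n)) base-link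

      toW : M.F₀ A ⇒ W
      toW = MF.fold A base algebra

      toW-κ : ∀ n → toW ∘ M.F₁ (κ n) ≈ w n
      toW-κ n = MF.fold-ext (Y n)
        (begin
          (toW ∘ M.F₁ (κ n)) ∘ M.η _   ≈⟨ pullʳ (Equiv.sym (M.unit.commute (κ n))) ⟩
          toW ∘ (M.η A ∘ κ n)          ≈⟨ pullˡ (MF.fold-η A) ⟩
          base ∘ κ n                   ≈⟨ κ-rep-commute _ base-link n ⟩
          w n ∘ M.η _                  ∎)
        (IsHom-∘ F (MF.fold-σ A) (F₁-isHom (κ n))) (w-isHom n)

      fromW-link : ∀ n → M.F₁ (κ (suc n)) ∘ M.F₁ (y n) ≈ M.F₁ (κ n)
      fromW-link n = Equiv.trans (Equiv.sym M.homomorphism) (M.F-resp-≈ (κ-commute n))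

      fromW : W ⇒ M.F₀ A
      fromW = rep (λ n → M.F₁ (κ n)) fromW-link

      fromW-w : ∀ n → fromW ∘ w n ≈ M.F₁ (κ n)
      fromW-w = rep-commute _ fromW-link

      fromW-isHom : IsHom F algebra (α A) fromW
      fromW-isHom = FW.rep-ext λ n → begin
        (fromW ∘ algebra) ∘ F.F₁ (w n)        ≈⟨ pullʳ (Equiv.sym (w-isHom n)) ⟩
        fromW ∘ (w n ∘ α (Y n))               ≈⟨ pullˡ (fromW-w n) ⟩
        M.F₁ (κ n) ∘ α (Y n)                  ≈⟨ F₁-isHom (κ n) ⟩
        α A ∘ F.F₁ (M.F₁ (κ n))               ≈⟨ pullʳ (Equiv.trans (Equiv.sym F.homomorphism)
                                                               (F.F-resp-≈ (fromW-w n))) ⟨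
        (α A ∘ F.F₁ fromW) ∘ F.F₁ (w n)       ∎

      fromW-toW : fromW ∘ toW ≈ id
      fromW-toW = MF.fold-ext A
        -- Two endomorphisms of the free algebra M A need comparing only on generators, and A is
        -- itself a colimit, so only on each Y n.
        (κ-rep-ext λ n → begin
          ((fromW ∘ toW) ∘ M.η A) ∘ κ n       ≈⟨ ∘-resp-≈ˡ (pullʳ (MF.fold-η A)) ⟩
          (fromW ∘ base) ∘ κ n                ≈⟨ pullʳ (κ-rep-commute _ base-link n) ⟩
          fromW ∘ (w n ∘ M.η _)               ≈⟨ pullˡ (fromW-w n) ⟩
          M.F₁ (κ n) ∘ M.η _                  ≈⟨ M.unit.commute (κ n) ⟨
          M.η A ∘ κ n                         ≈⟨ ∘-resp-≈ˡ identityˡ ⟨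
          (id ∘ M.η A) ∘ κ n                  ∎)
        (IsHom-∘ F fromW-isHom (MF.fold-σ A)) (IsHom-id F)

-- Liftings of a monad to algebras, and the distributive laws they induce.

-- A monad on the category of G-algebras lying over S. Homomorphisms are maps of C with a property,
-- so the functor and monad laws are those of S, and only preservation of homomorphisms by S, η and
-- μ has to be recorded.
record Lifting {C : Category o s s} (G : Endofunctor C) (S : Monad C) : Set (o ⊔ s) where
  open Category C
  open Iteration {C = C}
  private
    module G = Functor G
    module S = Monad S
  field
    lifted       : ∀ {A} → G.F₀ A ⇒ A → G.F₀ (S.F₀ A) ⇒ S.F₀ A
    lift-isHom : ∀ {A B} {a : G.F₀ A ⇒ A} {b : G.F₀ B ⇒ B} {f : A ⇒ B} →
                 IsHom G a b f → IsHom G (lifted a) (lifted b) (S.F₁ f)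
    η-isHom    : ∀ {A} (a : G.F₀ A ⇒ A) → IsHom G a (lifted a) (S.η A)
    μ-isHom    : ∀ {A} (a : G.F₀ A ⇒ A) → IsHom G (lifted (lifted a)) (lifted a) (S.μ A)

module LiftedLaw {C : Category o s s} (G : Endofunctor C)
  (T : Monad C) (inclusion : NaturalTransformation G (Monad.functor T))
  (iterative : FreeStructure.AlgebraicallyFree G T inclusion)
  (S : Monad C) (lifting : Lifting G S) where

  open Category C
  open HomReasoning
  open Composites C
  open Iteration {C = C}
  open Lifting lifting renaming (μ-isHom to S-μ-isHom)
  open FreeStructure G T inclusion public
  private
    module G = Functor G
    module T = Monad T
    module S = Monad S
    module Fold X = Iterative (iterative X)

  δ : ∀ X → T.F₀ (S.F₀ X) ⇒ S.F₀ (T.F₀ X)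
  δ X = Fold.fold (S.F₀ X) (S.F₁ (T.η X)) (lifted (α X))

  δ-η : ∀ X → δ X ∘ T.η (S.F₀ X) ≈ S.F₁ (T.η X)
  δ-η X = Fold.fold-η (S.F₀ X)

  δ-isHom : ∀ X → IsHom G (α (S.F₀ X)) (lifted (α X)) (δ X)
  δ-isHom X = Fold.fold-σ (S.F₀ X)

  -- Both sides of naturality and of each axiom are homomorphisms out of a free G-algebra, so they
  -- agree once they agree on generators, where `δ-η` computes them.
  distributiveLaw : DistributiveLaw T S
  distributiveLaw = record
    { law = record
      { η       = δ
      ; commute = λ {X} {Y} f → Fold.fold-ext (S.F₀ X)
          (begin
            (δ Y ∘ T.F₁ (S.F₁ f)) ∘ T.η _      ≈⟨ pullʳ (Equiv.sym (T.unit.commute (S.F₁ f))) ⟩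
            δ Y ∘ (T.η _ ∘ S.F₁ f)             ≈⟨ pullˡ (δ-η Y) ⟩
            S.F₁ (T.η Y) ∘ S.F₁ f              ≈⟨ S.square (T.unit.commute f) ⟩
            S.F₁ (T.F₁ f) ∘ S.F₁ (T.η X)       ≈⟨ pullʳ (δ-η X) ⟨
            (S.F₁ (T.F₁ f) ∘ δ X) ∘ T.η _      ∎)
          (IsHom-∘ G (δ-isHom Y) (F₁-isHom (S.F₁ f)))
          (IsHom-∘ G (lift-isHom (F₁-isHom f)) (δ-isHom X))
      }
    ; unit-T = λ {X} → δ-η X
    ; unit-S = λ {X} → Fold.fold-ext X
        (begin
          (δ X ∘ T.F₁ (S.η X)) ∘ T.η X         ≈⟨ pullʳ (Equiv.sym (T.unit.commute (S.η X))) ⟩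
          δ X ∘ (T.η _ ∘ S.η X)                ≈⟨ pullˡ (δ-η X) ⟩
          S.F₁ (T.η X) ∘ S.η X                 ≈⟨ S.unit.commute (T.η X) ⟨
          S.η (T.F₀ X) ∘ T.η X                 ∎)
        (IsHom-∘ G (δ-isHom X) (F₁-isHom (S.η X)))
        (η-isHom (α X))
    ; mult-T = λ {X} → Fold.fold-ext (T.F₀ (S.F₀ X))
        (begin
          (δ X ∘ T.μ _) ∘ T.η _                ≈⟨ pullʳ T.μ-identityʳ ⟩
          δ X ∘ id                             ≈⟨ identityʳ ⟩
          δ X                                  ≈⟨ cancel (Equiv.trans (Equiv.sym S.homomorphism)
                                                    (Equiv.trans (S.F-resp-≈ T.μ-identityʳ) S.identity)) ⟨
          S.F₁ (T.μ X) ∘ (S.F₁ (T.η _) ∘ δ X)  ≈⟨ ∘-resp-≈ʳ (pullˡ (δ-η (T.F₀ X))) ⟨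
          S.F₁ (T.μ X) ∘ (δ _ ∘ (T.η _ ∘ δ X)) ≈⟨ ∘-resp-≈ʳ (pullʳ (Equiv.sym (T.unit.commute (δ X)))) ⟨
          S.F₁ (T.μ X) ∘ ((δ _ ∘ T.F₁ (δ X)) ∘ T.η _)  ≈⟨ assoc ⟨
          (S.F₁ (T.μ X) ∘ (δ _ ∘ T.F₁ (δ X))) ∘ T.η _  ∎)
        (IsHom-∘ G (δ-isHom X) (μ-isHom (S.F₀ X)))
        (IsHom-∘ G (lift-isHom (μ-isHom X)) (IsHom-∘ G (δ-isHom (T.F₀ X)) (F₁-isHom (δ X))))
    ; mult-S = λ {X} → Fold.fold-ext (S.F₀ (S.F₀ X))
        (begin
          (δ X ∘ T.F₁ (S.μ X)) ∘ T.η _         ≈⟨ pullʳ (Equiv.sym (T.unit.commute (S.μ X))) ⟩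
          δ X ∘ (T.η _ ∘ S.μ X)                ≈⟨ pullˡ (δ-η X) ⟩
          S.F₁ (T.η X) ∘ S.μ X                 ≈⟨ S.mult.commute (T.η X) ⟨
          S.μ _ ∘ S.F₁ (S.F₁ (T.η X))          ≈⟨ ∘-resp-≈ʳ (S.F-resp-≈ (δ-η X)) ⟨
          S.μ _ ∘ S.F₁ (δ X ∘ T.η _)           ≈⟨ ∘-resp-≈ʳ S.homomorphism ⟩
          S.μ _ ∘ (S.F₁ (δ X) ∘ S.F₁ (T.η _))  ≈⟨ ∘-resp-≈ʳ (pullʳ (δ-η (S.F₀ X))) ⟨
          S.μ _ ∘ ((S.F₁ (δ X) ∘ δ _) ∘ T.η _) ≈⟨ assoc ⟨
          (S.μ _ ∘ (S.F₁ (δ X) ∘ δ _)) ∘ T.η _ ∎)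
        (IsHom-∘ G (δ-isHom X) (F₁-isHom (S.μ X)))
        (IsHom-∘ G (S-μ-isHom (α X)) (IsHom-∘ G (lift-isHom (δ-isHom X)) (δ-isHom (S.F₀ X))))
    }

  -- On a single layer of G the law δ is the lifted structure map; this is where δ becomes
  -- comparable with `d`.
  δ-inclusion : ∀ X → δ X ∘ NaturalTransformation.η inclusion (S.F₀ X) ≈ lifted (α X) ∘ G.F₁ (S.F₁ (T.η X))
  δ-inclusion X = begin
    δ X ∘ NaturalTransformation.η inclusion (S.F₀ X)
      ≈⟨ ∘-resp-≈ʳ (α-η (S.F₀ X)) ⟨
    δ X ∘ (α (S.F₀ X) ∘ G.F₁ (T.η _))
      ≈⟨ extend (δ-isHom X) ⟩
    lifted (α X) ∘ (G.F₁ (δ X) ∘ G.F₁ (T.η _))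
      ≈⟨ ∘-resp-≈ʳ (Equiv.trans (Equiv.sym G.homomorphism) (G.F-resp-≈ (δ-η X))) ⟩
    lifted (α X) ∘ G.F₁ (S.F₁ (T.η X)) ∎

-- The lifting defined by a structural law.

module StructuralLifting {C : Category o s s} (lfp : LocallyFinitelyPresentable C)
  (L : SimpleStructuralLaw lfp)
  (iterative : FreeStructure.AlgebraicallyFree (SimpleStructuralLaw.Sig L)
    (SimpleStructuralLaw.S.monad L) (SimpleStructuralLaw.S.inclusion L)) where

  open Category C
  open HomReasoning
  open Composites C
  open FiniteCoproducts (LocallyFinitelyPresentable.cocomplete lfp)
  open Copairing (LocallyFinitelyPresentable.cocomplete lfp)
  open Iteration {C = C}
  open SimpleStructuralLaw L
  open FreeStructure Sig S.monad S.inclusion renaming (α to σ)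
  private module Iter X = Iterative (iterative X)

  -- One application of `d`, with its result evaluated in the S-algebra β: p interprets the
  -- recursive premises, q and r the two kinds of variables.
  rule : ∀ {Z Y B} → S.F₀ B ⇒ B → Γ.F₀ (Z , S.F₀ Y) ⇒ B → Z ⇒ B → Y ⇒ B → Γ.F₀ (Sig.F₀ Z , Y) ⇒ B
  rule {Z} {Y} β p q r = β ∘ (S.F₁ [ [ p , q ] , r ] ∘ d.η (Z , Y))

  rule-resp-≈ : ∀ {Z Y B} {β : S.F₀ B ⇒ B} {p p′ : Γ.F₀ (Z , S.F₀ Y) ⇒ B} {q q′ : Z ⇒ B} {r r′ : Y ⇒ B} →
    p ≈ p′ → q ≈ q′ → r ≈ r′ → rule β p q r ≈ rule β p′ q′ r′
  rule-resp-≈ u v w = ∘-resp-≈ʳ (∘-resp-≈ˡ (S.F-resp-≈ ([]-resp-≈ ([]-resp-≈ u v) w)))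

  rule-natural : ∀ {Z Y Z′ Y′ B} {β : S.F₀ B ⇒ B} {p : Γ.F₀ (Z , S.F₀ Y) ⇒ B} {q : Z ⇒ B} {r : Y ⇒ B}
    (h : Z′ ⇒ Z) (w : Y′ ⇒ Y) →
    rule β p q r ∘ Γ.F₁ (Sig.F₁ h , w) ≈ rule β (p ∘ Γ.F₁ (h , S.F₁ w)) (q ∘ h) (r ∘ w)
  rule-natural {β = β} {p} {q} {r} h w = begin
    (β ∘ (S.F₁ [ [ p , q ] , r ] ∘ d.η _)) ∘ Γ.F₁ (Sig.F₁ h , w)
      ≈⟨ pullʳ (pullʳ (d.commute (h , w))) ⟩
    β ∘ (S.F₁ [ [ p , q ] , r ] ∘ (S.F₁ ((Γ.F₁ (h , S.F₁ w) +₁ h) +₁ w) ∘ d.η _))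
      ≈⟨ ∘-resp-≈ʳ (pullˡ (Equiv.trans (Equiv.sym S.homomorphism) (S.F-resp-≈
           (Equiv.trans []-∘-+₁ ([]-resp-≈ []-∘-+₁ Equiv.refl))))) ⟩
    rule β (p ∘ Γ.F₁ (h , S.F₁ w)) (q ∘ h) (r ∘ w) ∎

  ∘-rule : ∀ {Z Y B B′} {β : S.F₀ B ⇒ B} {β′ : S.F₀ B′ ⇒ B′} {p : Γ.F₀ (Z , S.F₀ Y) ⇒ B}
    {q : Z ⇒ B} {r : Y ⇒ B} {h : B ⇒ B′} → h ∘ β ≈ β′ ∘ S.F₁ h → h ∘ rule β p q r ≈ rule β′ (h ∘ p) (h ∘ q) (h ∘ r)
  ∘-rule {β = β} {β′} {p} {q} {r} {h} e = begin
    h ∘ (β ∘ (S.F₁ [ [ p , q ] , r ] ∘ d.η _))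
      ≈⟨ extend e ⟩
    β′ ∘ (S.F₁ h ∘ (S.F₁ [ [ p , q ] , r ] ∘ d.η _))
      ≈⟨ ∘-resp-≈ʳ (pullˡ (Equiv.trans (Equiv.sym S.homomorphism) (S.F-resp-≈
           (Equiv.trans ∘-[] ([]-resp-≈ ∘-[] Equiv.refl))))) ⟩
    rule β′ (h ∘ p) (h ∘ q) (h ∘ r) ∎

  -- The S-algebra υ folds S Y back to Y, so that the recursive result f, available on Γ(Z , Y)
  -- only, applies to the premises on Γ(Z , S Y). Source and target algebras are kept distinct so
  -- that one step serves both `act` and maps out of it.
  ruleStep : ∀ {X Y B} → S.F₀ Y ⇒ Y → S.F₀ B ⇒ B → X ⇒ B → Y ⇒ B → Step Sig (Γ ∘F (Id ※ const Y)) X B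
  ruleStep υ β κ y = record
    { Φ         = λ k f → rule β (f ∘ Γ.F₁ (id , υ)) (κ ∘ k) y
    ; Φ-resp-≈  = λ p q → rule-resp-≈ (∘-resp-≈ˡ q) (∘-resp-≈ʳ p) Equiv.refl
    ; Φ-natural = λ h k f → Equiv.trans (rule-natural h id) (rule-resp-≈
        (Equiv.trans (pullʳ (Γ.square
          ( Equiv.trans identityˡ (Equiv.sym identityʳ)
          , Equiv.trans (∘-resp-≈ʳ S.identity) (Equiv.trans identityʳ (Equiv.sym identityˡ)))))
          (Equiv.sym assoc))
        assoc identityʳ)
    }

  -- Sealed, since `act` is used below only through its two recursion equations.
  abstract
    act : ∀ {A} → Γ.F₀ (A , S.F₀ A) ⇒ A → Γ.F₀ (S.F₀ A , S.F₀ A) ⇒ S.F₀ A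
    act {A} a = Iter.iter A (Γ ∘F (Id ※ const (S.F₀ A))) (Γ-cocontinuous₁ (S.F₀ A))
      (ruleStep (S.μ A) (S.μ A) id id) (S.η A ∘ a)

    act-η : ∀ {A} (a : Γ.F₀ (A , S.F₀ A) ⇒ A) → act a ∘ Γ.F₁ (S.η A , id) ≈ S.η A ∘ a
    act-η {A} a = Iter.iter-η A {Γ ∘F (Id ※ const (S.F₀ A))} (Γ-cocontinuous₁ (S.F₀ A))
      (ruleStep (S.μ A) (S.μ A) id id) (S.η A ∘ a)

    act-σ : ∀ {A} (a : Γ.F₀ (A , S.F₀ A) ⇒ A) →
      act a ∘ Γ.F₁ (σ A , id) ≈ rule (S.μ A) (act a ∘ Γ.F₁ (id , S.μ A)) id id
    act-σ {A} a = Equiv.trans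
      (Iter.iter-σ A {Γ ∘F (Id ※ const (S.F₀ A))} (Γ-cocontinuous₁ (S.F₀ A))
        (ruleStep (S.μ A) (S.μ A) id id) (S.η A ∘ a))
      (rule-resp-≈ Equiv.refl identityˡ Equiv.refl)

  -- Both sides are iterates of one step, that of `act` with its result pushed along the S-algebra
  -- map h; hence it is enough to check generators. The instances h = `S.F₁ f` and h = `S.μ A` give
  -- functoriality of the lifting and its multiplication.
  act-hom : ∀ {A B} {a : Γ.F₀ (A , S.F₀ A) ⇒ A} {b : Γ.F₀ (B , S.F₀ B) ⇒ B} {h : S.F₀ A ⇒ S.F₀ B} →
    h ∘ S.μ A ≈ S.μ B ∘ S.F₁ h →
    h ∘ (S.η A ∘ a) ≈ act b ∘ Γ.F₁ (h ∘ S.η A , h) →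
    h ∘ act a ≈ act b ∘ Γ.F₁ (h , h)
  act-hom {A} {B} {a} {b} {h} hμ ha =
    Iter.iter-ext A {Γ ∘F (Id ※ const (S.F₀ A))} (Γ-cocontinuous₁ (S.F₀ A)) (ruleStep (S.μ A) (S.μ B) h h)
      (begin
        (h ∘ act a) ∘ Γ.F₁ (S.η A , id)            ≈⟨ pullʳ (act-η a) ⟩
        h ∘ (S.η A ∘ a)                            ≈⟨ ha ⟩
        act b ∘ Γ.F₁ (h ∘ S.η A , h)               ≈⟨ ∘-resp-≈ʳ (Γ.F-resp-≈ (Equiv.refl , Equiv.sym identityʳ)) ⟩
        act b ∘ Γ.F₁ (h ∘ S.η A , h ∘ id)          ≈⟨ pullʳ (Equiv.sym Γ.homomorphism) ⟨
        (act b ∘ Γ.F₁ (h , h)) ∘ Γ.F₁ (S.η A , id) ∎)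
      (begin
        (h ∘ act a) ∘ Γ.F₁ (σ A , id)
          ≈⟨ pullʳ (act-σ a) ⟩
        h ∘ rule (S.μ A) (act a ∘ Γ.F₁ (id , S.μ A)) id id
          ≈⟨ ∘-rule hμ ⟩
        rule (S.μ B) (h ∘ (act a ∘ Γ.F₁ (id , S.μ A))) (h ∘ id) (h ∘ id)
          ≈⟨ rule-resp-≈ (Equiv.sym assoc) Equiv.refl identityʳ ⟩
        rule (S.μ B) ((h ∘ act a) ∘ Γ.F₁ (id , S.μ A)) (h ∘ id) h ∎)
      (begin
        (act b ∘ Γ.F₁ (h , h)) ∘ Γ.F₁ (σ A , id)
          ≈⟨ pullʳ (Γ.square (hσ , Equiv.trans identityʳ (Equiv.sym identityˡ))) ⟩
        act b ∘ (Γ.F₁ (σ B , id) ∘ Γ.F₁ (Sig.F₁ h , h))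
          ≈⟨ pullˡ (act-σ b) ⟩
        rule (S.μ B) (act b ∘ Γ.F₁ (id , S.μ B)) id id ∘ Γ.F₁ (Sig.F₁ h , h)
          ≈⟨ rule-natural h h ⟩
        rule (S.μ B) ((act b ∘ Γ.F₁ (id , S.μ B)) ∘ Γ.F₁ (h , S.F₁ h)) (id ∘ h) (id ∘ h)
          ≈⟨ rule-resp-≈ (Equiv.trans (pullʳ (Γ.square (id-comm , Equiv.sym hμ))) (Equiv.sym assoc))
                         id-comm identityˡ ⟩
        rule (S.μ B) ((act b ∘ Γ.F₁ (h , h)) ∘ Γ.F₁ (id , S.μ A)) (h ∘ id) h ∎)
    where
      id-comm : id ∘ h ≈ h ∘ id
      id-comm = Equiv.trans identityˡ (Equiv.sym identityʳ)

      hσ : h ∘ σ A ≈ σ B ∘ Sig.F₁ h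
      hσ = begin
        h ∘ (S.μ A ∘ S.ηF _)            ≈⟨ extend hμ ⟩
        S.μ B ∘ (S.F₁ h ∘ S.ηF _)       ≈⟨ pullʳ (S.inclusion.commute h) ⟨
        σ B ∘ Sig.F₁ h                  ∎

  liftAlgebra : ∀ {A} → Γ.F₀ (A , S.F₀ A) ⇒ A → Γ.F₀ (S.F₀ A , S.F₀ (S.F₀ A)) ⇒ S.F₀ A
  liftAlgebra {A} a = act a ∘ Γ.F₁ (id , S.μ A)

  act-hom⇒isHom : ∀ {A B} {a : Γ.F₀ (A , S.F₀ A) ⇒ A} {b : Γ.F₀ (B , S.F₀ B) ⇒ B} {h : S.F₀ A ⇒ S.F₀ B} →
    h ∘ S.μ A ≈ S.μ B ∘ S.F₁ h → h ∘ act a ≈ act b ∘ Γ.F₁ (h , h) →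
    IsHom ΓSΔ (liftAlgebra a) (liftAlgebra b) h
  act-hom⇒isHom {A} {B} {a} {b} {h} hμ p = begin
    h ∘ (act a ∘ Γ.F₁ (id , S.μ A))             ≈⟨ extend p ⟩
    act b ∘ (Γ.F₁ (h , h) ∘ Γ.F₁ (id , S.μ A))  ≈⟨ pullʳ (Γ.square (Equiv.trans identityˡ (Equiv.sym identityʳ) , Equiv.sym hμ)) ⟨
    liftAlgebra b ∘ Γ.F₁ (h , S.F₁ h)           ∎

  lifting : Lifting ΓSΔ S.monad
  lifting = record
    { lifted       = liftAlgebra
    ; lift-isHom = λ {A} {B} {a} {b} {f} p → act-hom⇒isHom (Equiv.sym (S.mult.commute f))
        (act-hom (Equiv.sym (S.mult.commute f)) (begin
          S.F₁ f ∘ (S.η A ∘ a)                               ≈⟨ extend (S.unit.commute f) ⟨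
          S.η B ∘ (f ∘ a)                                    ≈⟨ ∘-resp-≈ʳ p ⟩
          S.η B ∘ (b ∘ Γ.F₁ (f , S.F₁ f))                    ≈⟨ extend (act-η b) ⟨
          act b ∘ (Γ.F₁ (S.η B , id) ∘ Γ.F₁ (f , S.F₁ f))    ≈⟨ ∘-resp-≈ʳ (Γ.homomorphism) ⟨
          act b ∘ Γ.F₁ (S.η B ∘ f , id ∘ S.F₁ f)             ≈⟨ ∘-resp-≈ʳ (Γ.F-resp-≈ (S.unit.commute f , identityˡ)) ⟩
          act b ∘ Γ.F₁ (S.F₁ f ∘ S.η A , S.F₁ f)             ∎))
    ; η-isHom    = λ {A} a → begin
        S.η A ∘ a                                            ≈⟨ act-η a ⟨
        act a ∘ Γ.F₁ (S.η A , id)                            ≈⟨ ∘-resp-≈ʳ (Γ.F-resp-≈ (identityˡ , S.μ-identityˡ)) ⟨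
        act a ∘ Γ.F₁ (id ∘ S.η A , S.μ A ∘ S.F₁ (S.η A))     ≈⟨ pullʳ (Equiv.sym Γ.homomorphism) ⟨
        liftAlgebra a ∘ Γ.F₁ (S.η A , S.F₁ (S.η A))          ∎
    ; μ-isHom    = λ {A} a → act-hom⇒isHom (Equiv.sym S.μ-assoc)
        (act-hom (Equiv.sym S.μ-assoc) (begin
          S.μ A ∘ (S.η _ ∘ liftAlgebra a)                    ≈⟨ cancel S.μ-identityʳ ⟩
          act a ∘ Γ.F₁ (id , S.μ A)                          ≈⟨ ∘-resp-≈ʳ (Γ.F-resp-≈ (S.μ-identityʳ , Equiv.refl)) ⟨
          act a ∘ Γ.F₁ (S.μ A ∘ S.η _ , S.μ A)               ∎))
    }

  -- The first argument has depth one in `Sig`: a single use of `act-σ` brings in `d`, after which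
  -- the premises lie over generators and `act-η` ends the recursion.
  liftAlgebra-d : ∀ {X A} (a : Γ.F₀ (A , S.F₀ A) ⇒ A) (f : X ⇒ A) →
    liftAlgebra a ∘ Γ.F₁ (S.F₁ f ∘ S.ηF X , S.F₁ (S.F₁ f) ∘ (S.η _ ∘ S.η X)) ≈
    S.F₁ [ [ a ∘ Γ.F₁ (f , S.F₁ f) , f ] , f ] ∘ d.η (X , X)
  liftAlgebra-d {X} {A} a f = begin
    (act a ∘ Γ.F₁ (id , S.μ A)) ∘ Γ.F₁ (S.F₁ f ∘ S.ηF X , S.F₁ (S.F₁ f) ∘ (S.η _ ∘ S.η X))
      ≈⟨ pullʳ (Γ.square (first , second)) ⟩
    act a ∘ (Γ.F₁ (σ A , id) ∘ Γ.F₁ (Sig.F₁ (S.η A ∘ f) , S.η A ∘ f))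
      ≈⟨ pullˡ (act-σ a) ⟩
    rule (S.μ A) (act a ∘ Γ.F₁ (id , S.μ A)) id id ∘ Γ.F₁ (Sig.F₁ (S.η A ∘ f) , S.η A ∘ f)
      ≈⟨ rule-natural (S.η A ∘ f) (S.η A ∘ f) ⟩
    rule (S.μ A) ((act a ∘ Γ.F₁ (id , S.μ A)) ∘ Γ.F₁ (S.η A ∘ f , S.F₁ (S.η A ∘ f)))
        (id ∘ (S.η A ∘ f)) (id ∘ (S.η A ∘ f))
      ≈⟨ rule-resp-≈ premise identityˡ identityˡ ⟩
    rule (S.μ A) (S.η A ∘ (a ∘ Γ.F₁ (f , S.F₁ f))) (S.η A ∘ f) (S.η A ∘ f)
      -- All three interpretations factor through `S.η A`; pulled out of the copairing it becomes
      -- `S.F₁ (S.η A)`, which `S.μ A` cancels.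
      ≈⟨ ∘-resp-≈ʳ (∘-resp-≈ˡ (Equiv.trans (Equiv.sym S.homomorphism) (S.F-resp-≈
           (Equiv.trans ∘-[] ([]-resp-≈ ∘-[] Equiv.refl))))) ⟨
    S.μ A ∘ ((S.F₁ (S.η A) ∘ S.F₁ [ [ a ∘ Γ.F₁ (f , S.F₁ f) , f ] , f ]) ∘ d.η (X , X))
      ≈⟨ Equiv.trans (∘-resp-≈ʳ assoc) (cancel S.μ-identityˡ) ⟩
    S.F₁ [ [ a ∘ Γ.F₁ (f , S.F₁ f) , f ] , f ] ∘ d.η (X , X) ∎
    where
      first : id ∘ (S.F₁ f ∘ S.ηF X) ≈ σ A ∘ Sig.F₁ (S.η A ∘ f)
      first = begin
        id ∘ (S.F₁ f ∘ S.ηF X)                     ≈⟨ identityˡ ⟩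
        S.F₁ f ∘ S.ηF X                            ≈⟨ S.inclusion.commute f ⟨
        S.ηF A ∘ Sig.F₁ f                          ≈⟨ ∘-resp-≈ˡ (α-η A) ⟨
        (σ A ∘ Sig.F₁ (S.η A)) ∘ Sig.F₁ f          ≈⟨ pullʳ (Equiv.sym Sig.homomorphism) ⟩
        σ A ∘ Sig.F₁ (S.η A ∘ f)                   ∎

      second : S.μ A ∘ (S.F₁ (S.F₁ f) ∘ (S.η _ ∘ S.η X)) ≈ id ∘ (S.η A ∘ f)
      second = begin
        S.μ A ∘ (S.F₁ (S.F₁ f) ∘ (S.η _ ∘ S.η X))  ≈⟨ ∘-resp-≈ʳ (extend (S.unit.commute (S.F₁ f))) ⟨
        S.μ A ∘ (S.η _ ∘ (S.F₁ f ∘ S.η X))         ≈⟨ cancel S.μ-identityʳ ⟩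
        S.F₁ f ∘ S.η X                             ≈⟨ S.unit.commute f ⟨
        S.η A ∘ f                                  ≈⟨ identityˡ ⟨
        id ∘ (S.η A ∘ f)                           ∎

      premise : (act a ∘ Γ.F₁ (id , S.μ A)) ∘ Γ.F₁ (S.η A ∘ f , S.F₁ (S.η A ∘ f)) ≈ S.η A ∘ (a ∘ Γ.F₁ (f , S.F₁ f))
      premise = begin
        (act a ∘ Γ.F₁ (id , S.μ A)) ∘ Γ.F₁ (S.η A ∘ f , S.F₁ (S.η A ∘ f))
          ≈⟨ pullʳ (Γ.square (identityˡ , Equiv.trans (∘-resp-≈ʳ S.homomorphism)
               (Equiv.trans (cancel S.μ-identityˡ) (Equiv.sym identityˡ)))) ⟩
        act a ∘ (Γ.F₁ (S.η A , id) ∘ Γ.F₁ (f , S.F₁ f))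
          ≈⟨ extend (act-η a) ⟩
        S.η A ∘ (a ∘ Γ.F₁ (f , S.F₁ f)) ∎

-- The free algebra on the initial object.

module ConstantFreeness {C : Category o s s} (lfp : LocallyFinitelyPresentable C) (G : Endofunctor C)
  (T : Monad C) (inclusion : NaturalTransformation G (Monad.functor T))
  (iterative : FreeStructure.AlgebraicallyFree G T inclusion) where

  open Category C
  open FiniteCoproducts (LocallyFinitelyPresentable.cocomplete lfp)
  open Composites C
  open Iteration {C = C}
  open Iterative (iterative ∅)
  open Functor G

  -- Folding into the algebra on ∅ inverts the unit. The composite on T ∅ is an endomorphism of a
  -- free algebra, and `G∅-ext` is what makes the unit itself a homomorphism from ∅.
  constantFree : F₀ ∅ ⇒ ∅ → (∀ {X} (f g : F₀ ∅ ⇒ X) → f ≈ g) → ConstantFree lfp T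
  constantFree ¡G G∅-ext = record
    { inv  = fold id ¡G
    ; isoˡ = fold-η
    ; isoʳ = fold-ext
        (Equiv.trans (pullʳ fold-η) (Equiv.trans identityʳ (Equiv.sym identityˡ)))
        (IsHom-∘ G (G∅-ext _ _) fold-σ) (IsHom-id G)
    }

-- The distributive law and its properties.

theorem3p5 : ∀ {o s : Level} (C : Category o s s) (lfp : LocallyFinitelyPresentable C)
    (L : SimpleStructuralLaw lfp) →
    let open Category C
        open FiniteCoproducts (LocallyFinitelyPresentable.cocomplete lfp)
        open SimpleStructuralLaw L
    in
    (T* : FreeMonad ΓSΔ) →
    let module T = FreeMonad T* in
    Σ[ Δ ∈ DistributiveLaw T.monad S.monad ]
      ((∀ (X : Obj) →
          DistributiveLaw.δ Δ X
            ∘ T.ηF (S.F₀ X)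
            ∘ Γ.F₁ (id {S.F₀ X} , S.η (S.F₀ X))
            ∘ Γ.F₁ (S.ηF X , S.η X)
          ≈ S.F₁ [ [ T.ηF X , T.η X ] , T.η X ] ∘ d.η (X , X))
      × ConstantFree lfp T.monad
      × Admissible lfp (Sη Δ))
theorem3p5 C lfp L T* = distributiveLaw , δ-d , T-constantFree , Sη-admissible
  where
    open Category C
    open HomReasoning
    open Composites C
    open LocallyFinitelyPresentable lfp
    open FiniteCoproducts cocomplete
    open Copairing cocomplete
    open SequentialColimits C
    open SimpleStructuralLaw L
    module T = FreeMonad T*

    algebraicallyFree : (F : Endofunctor C) → PreservesSeqColimits F → (M : FreeMonad F) →
      let module M = FreeMonad M in FreeStructure.AlgebraicallyFree F M.monad M.inclusion
    algebraicallyFree F pres =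
      AlgebraicFreeness.freeMonad-algebraicallyFree F (FreeAlgebra.iterative cocomplete F pres)

    Sig-preservesSeq : PreservesSeqColimits Sig
    Sig-preservesSeq = finitary⇒preservesSeq {F = Sig} Sig-finitary

    S-algebraicallyFree : FreeStructure.AlgebraicallyFree Sig S.monad S.inclusion
    S-algebraicallyFree = algebraicallyFree Sig Sig-preservesSeq Sig*

    S-preservesSeq : PreservesSeqColimits S.functor
    S-preservesSeq = MonadPreservesSeq.preservesSeq cocomplete Sig Sig-preservesSeq
      S.monad S.inclusion S-algebraicallyFree

    -- A chain enters `ΓSΔ` in both arguments at once; S preserves its colimit, and the two-variable
    -- diagonal property then applies.
    ΓSΔ-preservesSeq : PreservesSeqColimits ΓSΔ
    ΓSΔ-preservesSeq K = Diagonal.isSeqColimit Γ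
      (λ Y → finitary⇒preservesSeq {F = Γ ∘F (Id ※ const Y)} λ J _ → Γ-cocontinuous₁ Y J)
      (λ X → finitary⇒preservesSeq {F = Γ ∘F (const X ※ Id)} (Γ-finitary₂ X))
      K (S-preservesSeq K)

    T-algebraicallyFree : FreeStructure.AlgebraicallyFree ΓSΔ T.monad T.inclusion
    T-algebraicallyFree = algebraicallyFree ΓSΔ ΓSΔ-preservesSeq T*

    open StructuralLifting lfp L S-algebraicallyFree
    open LiftedLaw ΓSΔ T.monad T.inclusion T-algebraicallyFree S.monad lifting

    -- `δ-inclusion` reduces the left side to the lifting of the free algebra `α X`, evaluated by
    -- `liftAlgebra-d` along f = `T.η X`; `α-η` then turns the premise into `T.ηF X`.
    δ-d : ∀ X → δ X ∘ T.ηF (S.F₀ X) ∘ Γ.F₁ (id , S.η (S.F₀ X)) ∘ Γ.F₁ (S.ηF X , S.η X) ≈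
      S.F₁ [ [ T.ηF X , T.η X ] , T.η X ] ∘ d.η (X , X)
    δ-d X = begin
      δ X ∘ (T.ηF _ ∘ (Γ.F₁ (id , S.η _) ∘ Γ.F₁ (S.ηF X , S.η X)))
        ≈⟨ extend (δ-inclusion X) ⟩
      liftAlgebra (α X) ∘ (Γ.F₁ (S.F₁ (T.η X) , S.F₁ (S.F₁ (T.η X))) ∘ (Γ.F₁ (id , S.η _) ∘ Γ.F₁ (S.ηF X , S.η X)))
        ≈⟨ ∘-resp-≈ʳ (Equiv.trans (∘-resp-≈ʳ (Equiv.sym Γ.homomorphism)) (Equiv.sym Γ.homomorphism)) ⟩
      liftAlgebra (α X) ∘ Γ.F₁ (S.F₁ (T.η X) ∘ (id ∘ S.ηF X) , S.F₁ (S.F₁ (T.η X)) ∘ (S.η _ ∘ S.η X))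
        ≈⟨ ∘-resp-≈ʳ (Γ.F-resp-≈ (∘-resp-≈ʳ identityˡ , Equiv.refl)) ⟩
      liftAlgebra (α X) ∘ Γ.F₁ (S.F₁ (T.η X) ∘ S.ηF X , S.F₁ (S.F₁ (T.η X)) ∘ (S.η _ ∘ S.η X))
        ≈⟨ liftAlgebra-d (α X) (T.η X) ⟩
      S.F₁ [ [ α X ∘ Γ.F₁ (T.η X , S.F₁ (T.η X)) , T.η X ] , T.η X ] ∘ d.η (X , X)
        ≈⟨ ∘-resp-≈ˡ (S.F-resp-≈ ([]-resp-≈ ([]-resp-≈ (α-η X) Equiv.refl) Equiv.refl)) ⟩
      S.F₁ [ [ T.ηF X , T.η X ] , T.η X ] ∘ d.η (X , X) ∎

    -- The second argument is frozen at S ∅, so that the value of this functor at ∅ is `ΓSΔ` at ∅,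
    -- which is therefore initial.
    module Γ∅ = Preserved (Γ ∘F (Id ※ const (S.F₀ ∅))) (Γ-cocontinuous₁ (S.F₀ ∅))

    T-constantFree : ConstantFree lfp T.monad
    T-constantFree = ConstantFreeness.constantFree lfp ΓSΔ T.monad T.inclusion T-algebraicallyFree
      Γ∅.initial Γ∅.initial-unique

    Sη-admissible : Admissible lfp (Sη distributiveLaw)
    Sη-admissible = record
      -- The component of `Sη` at ∅ is S applied to the invertible unit of T, and functors preserve
      -- isomorphisms.
      { inv  = S.F₁ inv
      ; isoˡ = Equiv.trans (Equiv.sym S.homomorphism) (Equiv.trans (S.F-resp-≈ isoˡ) S.identity)
      ; isoʳ = Equiv.trans (Equiv.sym S.homomorphism) (Equiv.trans (S.F-resp-≈ isoʳ) S.identity)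
      }
      where open IsIso T-constantFree
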